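{- Simple $2$-$(55,10,m)$ designs exist for every $m\in\{4,5\}\cup\{8,9,\ldots,M\}$, where $M=443161355=\tfrac12\binom{53}{8}$.
   Context: A $t$-$(v,k,\lambda)$ design consists of a $v$-element set $P$ of points together with a collection $B$ of $k$-element subsets of $P$ (called blocks) such that every $t$-element subset of $P$ is contained in exactly $\lambda$ blocks. The design is simple if $B$ is a set, i.e. contains no repeated blocks. -}

module Defs where

open import Data.Nat using (ℕ)
open import Data.Fin using (Fin)
open import Data.Fin.Subset using (Subset; _⊆_; ∣_∣)
open import Data.Fin.Subset.Properties using (_⊆?_)
open import Data.List using (List; length; filter)
open import Data.List.Relation.Unary.All using (All)
open import Data.List.Relation.Unary.Unique.Propositional using (Unique)
open import Relation.Binary.PropositionalEquality using (_≡_)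
open import Data.Product using (Σ; _×_)

blocksContaining : {v : ℕ} → Subset v → List (Subset v) → ℕ
blocksContaining T B = length (filter (T ⊆?_) B)

IsDesign : (t v k lam : ℕ) → List (Subset v) → Set
IsDesign t v k lam B =
  All (λ b → ∣ b ∣ ≡ k) B ×
  ((T : Subset v) → ∣ T ∣ ≡ t → blocksContaining T B ≡ lam)

SimpleDesign : (t v k lam : ℕ) → Set
SimpleDesign t v k lam = Σ (List (Subset v)) (λ B → Unique B × IsDesign t v k lam B)

{-# OPTIONS --safe #-}
module Submission where

-- Points are the 55 edges of K₁₁, so blocks are graphs with ten edges on eleven vertices.  The
-- Mathieu group M₁₁ is 4-transitive on the vertices, hence has only two orbits on pairs of edges
-- (adjacent and disjoint).  An orbit of M₁₁ on 10-sets therefore covers every adjacent pair x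
-- times and every disjoint pair y times, and a union of orbits is a design as soon as Σ x = Σ y.
-- The family of all 10-sets has Σ x = Σ y = C(53,8).  Set aside 47 explicit orbits and add the
-- others one at a time, always choosing an orbit that pushes Σ x − Σ y the right way: as x ≤ 800
-- and y ≤ 400 for every orbit, this passes within a bounded distance of any prescribed λ with a
-- bounded imbalance.  Seventeen of the reserved orbits repair the imbalance, the other thirty
-- make up the missing λ.  This reaches every λ ≥ 76.  For smaller λ one takes unions of disjoint
-- relabelled copies of a 2-(55,10,4) design (an orbit of PSL(2,11) on ten-edge subgraphs of K₁₁)
-- and of a 2-(55,10,5) design, which give all λ = 4a + 5b; only λ = 11 needs a design of its own.

open import Defs
open import Algebra.Structures using (IsGroup)
open import Data.Bool using (Bool; true; false; _∧_; _∨_; T; if_then_else_)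
open import Data.Bool.ListAction using (any; all)
import Data.Bool.Properties as Bool
open import Data.Bool.Properties using (T?; T-∧; T-≡; ∨-comm)
open import Data.Fin using (Fin; zero; suc; #_; toℕ; fromℕ<)
open import Data.Fin.Permutation using (permutation)
open import Data.Fin.Properties using (all?; suc-injective; toℕ-fromℕ<) renaming (_≟_ to _≟ᶠ_)
open import Data.Fin.Subset using (Subset; inside; outside; _∈_; _⊆_; _∪_; ∣_∣; ⁅_⁆)
open import Data.Fin.Subset.Properties using (_∈?_; _⊆?_; ∣p∣≤n; drop-∷-⊆; in⊆in; out⊆; p⊂q⇒∣p∣<∣q∣; x∈p∪q⁺; x∈p∪q⁻; x∈⁅x⁆; x∈⁅y⁆⇒x≡y; ⊆-antisym)
open import Data.List using (List; []; _∷_; [_]; _++_; allFin; cartesianProduct; concat; concatMap; deduplicate; filter; length; map; take; upTo)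
import Data.List.Membership.DecPropositional as DecMembership
open import Data.List.Membership.Propositional using (lose) renaming (_∈_ to _∈ˡ_; _∉_ to _∉ˡ_)
open import Data.List.Membership.Propositional.Properties using (∈-++⁺ˡ; ∈-++⁺ʳ; ∈-++⁻; ∈-allFin; ∈-cartesianProduct⁺; ∈-deduplicate⁺; ∈-deduplicate⁻; ∈-filter⁺; ∈-filter⁻; ∈-map⁺; ∈-map⁻; ∈-∃++)
open import Data.List.Membership.Propositional.Properties.WithK using (unique∧set⇒bag)
open import Data.List.Properties using (++-assoc; ++-identityʳ; concat-++; filter-++; filter-notAll; filter-some; filter-≐; length-++; length-map; length-upTo; map-++; map-cong)
open import Data.List.Relation.Binary.BagAndSetEquality using (∼bag⇒↭)
open import Data.List.Relation.Binary.Permutation.Propositional using (_↭_; ↭-prep; ↭-refl; ↭-reflexive; ↭-swap; ↭-sym; ↭-trans; ↭⇒↭ₛ)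
open import Data.List.Relation.Binary.Permutation.Propositional.Properties using (++⁺ˡ; filter-↭; shift; shifts; ↭-length) renaming (++⁺ to ↭-++⁺; map⁺ to ↭-map⁺)
open import Data.List.Relation.Binary.Permutation.Setoid.Properties using (Unique-resp-↭)
open import Data.List.Relation.Unary.All using (All; []; _∷_)
import Data.List.Relation.Unary.All as All
import Data.List.Relation.Unary.All.Properties as All
open import Data.List.Relation.Unary.AllPairs using ([]; _∷_)
open import Data.List.Relation.Unary.Any using (Any; here; there)
import Data.List.Relation.Unary.Any as Any
import Data.List.Relation.Unary.Unique.DecPropositional as UniqueDec
open import Data.List.Relation.Unary.Unique.DecPropositional.Properties using (deduplicate-!)
open import Data.List.Relation.Unary.Unique.Propositional using (Unique)
import Data.List.Relation.Unary.Unique.Propositional.Properties as Unique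
open import Data.Maybe using (Maybe; just; nothing; is-just)
import Data.Maybe as Maybe
open import Data.Nat using (ℕ; zero; suc; z≤n; s≤s; s≤s⁻¹; _+_; _*_; _∸_; _^_; _/_; _%_; _≤_; _<_; _≡ᵇ_; _≤ᵇ_; _≤?_; _<?_; >-nonZero)
open import Data.Nat.Combinatorics using (nCk+nC[k+1]≡[n+1]C[k+1]) renaming (_C_ to _choose_)
open import Data.Nat.ListAction using (sum)
open import Data.Nat.ListAction.Properties using (sum-++; sum-↭)
open import Data.Nat.Properties hiding (suc-injective)
import Data.Nat.Properties as ℕ
open import Data.Nat.Tactic.RingSolver using (solve-∀)
open import Data.Product using (∃; ∃₂; _×_; _,_; proj₁; proj₂)
open import Data.Product.Properties using (≡-dec)
open import Data.Sum using (_⊎_; inj₁; inj₂; [_,_]′)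
open import Data.Unit using (⊤; tt)
open import Data.Vec using (Vec; []; _∷_; here; there; lookup; tabulate)
import Data.Vec as Vec
open import Data.Vec.Properties using ([]=⇒lookup; lookup∘tabulate; lookup⇒[]=; tabulate-cong; tabulate∘lookup) renaming (≡-dec to Vec-≡-dec)
open import Function using (_∘_; id; mk⇔)
open import Function.Bundles using (Equivalence)
open import Relation.Binary.Definitions using (DecidableEquality)
open import Relation.Binary.PropositionalEquality hiding ([_])
open import Relation.Nullary using (¬_; Dec; yes; no; does; contradiction)
open import Relation.Nullary.Decidable using (_×-dec_; _⊎-dec_; _→-dec_; ¬?; map′)
open import Relation.Unary using (Decidable)
open import Algebra.Properties.CommutativeMonoid.Sum +-0-commutativeMonoid using (sum-cong-≗; sum-permute) renaming (sum to Σᶠ)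

-- There are 33 C(53,8), about 3 · 10¹⁰, ten-sets, so the orbits outside the reserve cannot be
-- listed: they are only known to exist, by partitioning the invariant family that remains. What is
-- used of them is their total and the bounds x ≤ 100 · 8 and y ≤ 100 · 4: a block offers at most
-- 100 targets for an ordered pair of edges, and the stabiliser of the pair in M₁₁ has order 7920 /
-- 990 = 8 (adjacent) or 7920 / 1980 = 4 (disjoint). This is why the balance has to be repaired by
-- orbits with known numbers. Even those are not listed: x and y come from counting over the 7920
-- group elements and dividing by the order s of the stabiliser of a block. Counting pairs in blocks
-- gives x + 2 y = 720 / s, hence x - y ≡ 720 / s modulo 3. An imbalance that is not a multiple of 3
-- thus requires s divisible by 9, and the correctors must include such orbits. The reserved orbits
-- have pairwise distinct (x , y), which already shows that they are disjoint.

private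
  variable
    A B : Set

-- Unlike `toWitness`, this evaluates the decision only once.
witness : {P : Set} (P? : Dec P) → does P? ≡ true → P
witness (yes p) _ = p

-- Counting in lists

unique⇒length≤ : {xs ys : List A} → Unique xs → (∀ {z} → z ∈ˡ xs → z ∈ˡ ys) → length xs ≤ length ys
unique⇒length≤ {xs = []} _ _ = z≤n
unique⇒length≤ {xs = x ∷ xs} u@(_ ∷ u′) xs⊆ys with ∈-∃++ (xs⊆ys (here refl))
... | ps , qs , refl = begin
  suc (length xs)             ≤⟨ s≤s (unique⇒length≤ u′ sub) ⟩
  suc (length (ps ++ qs))     ≡⟨ cong suc (length-++ ps) ⟩
  suc (length ps + length qs) ≡⟨ +-suc (length ps) (length qs) ⟨
  length ps + suc (length qs) ≡⟨ length-++ ps ⟨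
  length (ps ++ x ∷ qs)       ∎
  where
  open ≤-Reasoning
  sub : ∀ {z} → z ∈ˡ xs → z ∈ˡ ps ++ qs
  sub z∈xs with ∈-++⁻ ps (xs⊆ys (there z∈xs))
  ... | inj₁ z∈ps         = ∈-++⁺ˡ z∈ps
  ... | inj₂ (here refl)  = contradiction z∈xs (Unique.Unique[x∷xs]⇒x∉xs u)
  ... | inj₂ (there z∈qs) = ∈-++⁺ʳ ps z∈qs

unique-↭ : {xs ys : List A} → Unique xs → Unique ys →
  (∀ {z} → z ∈ˡ xs → z ∈ˡ ys) → (∀ {z} → z ∈ˡ ys → z ∈ˡ xs) → xs ↭ ys
unique-↭ u w to from = ∼bag⇒↭ (unique∧set⇒bag u w (mk⇔ to from))

unique-resp-↭ : {xs ys : List A} → xs ↭ ys → Unique xs → Unique ys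
unique-resp-↭ p = Unique-resp-↭ (setoid _) (↭⇒↭ₛ p)

unique-++⁻ˡ : (xs : List A) {ys : List A} → Unique (xs ++ ys) → Unique xs
unique-++⁻ˡ []       _         = []
unique-++⁻ˡ (x ∷ xs) (x∉ ∷ u) = All.++⁻ˡ xs x∉ ∷ unique-++⁻ˡ xs u

count : {P : A → Set} → Decidable P → List A → ℕ
count P? xs = length (filter P? xs)

count-++ : {P : A → Set} (P? : Decidable P) (xs ys : List A) → count P? (xs ++ ys) ≡ count P? xs + count P? ys
count-++ P? xs ys = trans (cong length (filter-++ P? xs ys)) (length-++ (filter P? xs))

count-↭ : {P : A → Set} (P? : Decidable P) {xs ys : List A} → xs ↭ ys → count P? xs ≡ count P? ys
count-↭ P? p = ↭-length (filter-↭ P? p)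

count-≐ : {P : A → Set} {Q : A → Set} (P? : Decidable P) (Q? : Decidable Q) → (∀ {x} → P x → Q x) → (∀ {x} → Q x → P x) →
  (xs : List A) → count P? xs ≡ count Q? xs
count-≐ P? Q? to from xs = cong length (filter-≐ P? Q? (to , from) xs)

count-injective : {P : A → Set} {Q : B → Set} (P? : Decidable P) (Q? : Decidable Q) (f : A → B) → (∀ {x y} → f x ≡ f y → x ≡ y) →
  {xs : List A} {ys : List B} → Unique xs → (∀ {x} → x ∈ˡ xs → P x → f x ∈ˡ ys × Q (f x)) →
  count P? xs ≤ count Q? ys
count-injective P? Q? f f-inj {xs} {ys} u h = begin
  length (filter P? xs)         ≡⟨ length-map f (filter P? xs) ⟨
  length (map f (filter P? xs)) ≤⟨ unique⇒length≤ (Unique.map⁺ f-inj (Unique.filter⁺ P? u)) sub ⟩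
  length (filter Q? ys)         ∎
  where
  open ≤-Reasoning
  sub : ∀ {z} → z ∈ˡ map f (filter P? xs) → z ∈ˡ filter Q? ys
  sub z∈ with ∈-map⁻ f z∈
  ... | x , x∈ , refl with ∈-filter⁻ P? {xs = xs} x∈
  ... | x∈xs , px with h x∈xs px
  ... | fx∈ys , qfx = ∈-filter⁺ Q? fx∈ys qfx

count-⊆ : {P : A → Set} {Q : A → Set} (P? : Decidable P) (Q? : Decidable Q) → (∀ {x} → P x → Q x) → (xs : List A) → count P? xs ≤ count Q? xs
count-⊆ P? Q? h [] = z≤n
count-⊆ P? Q? h (x ∷ xs) with P? x | Q? x
... | yes p | yes q = s≤s (count-⊆ P? Q? h xs)
... | yes p | no ¬q = contradiction (h p) ¬q
... | no _  | yes q = m≤n⇒m≤1+n (count-⊆ P? Q? h xs)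
... | no _  | no _  = count-⊆ P? Q? h xs

count-⊎ : {P : A → Set} {Q : A → Set} {R : A → Set} (P? : Decidable P) (Q? : Decidable Q) (R? : Decidable R) →
  (∀ {x} → R x → P x ⊎ Q x) → (∀ {x} → P x → R x) → (∀ {x} → Q x → R x) → (∀ {x} → P x → ¬ Q x) →
  (xs : List A) → count R? xs ≡ count P? xs + count Q? xs
count-⊎ P? Q? R? split p⇒r q⇒r excl [] = refl
count-⊎ P? Q? R? split p⇒r q⇒r excl (x ∷ xs) with P? x | Q? x | R? x
... | yes p | yes q | _     = contradiction q (excl p)
... | yes p | no _  | yes _ = cong suc (count-⊎ P? Q? R? split p⇒r q⇒r excl xs)
... | yes p | no _  | no ¬r = contradiction (p⇒r p) ¬r
... | no _  | yes q | yes _ = trans (cong suc (count-⊎ P? Q? R? split p⇒r q⇒r excl xs)) (sym (+-suc _ _))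
... | no _  | yes q | no ¬r = contradiction (q⇒r q) ¬r
... | no ¬p | no ¬q | yes r = contradiction (split r) [ ¬p , ¬q ]′
... | no _  | no _  | no _  = count-⊎ P? Q? R? split p⇒r q⇒r excl xs

count-none : {P : A → Set} (P? : Decidable P) → (∀ {x} → ¬ P x) → (xs : List A) → count P? xs ≡ 0
count-none P? ¬p [] = refl
count-none P? ¬p (x ∷ xs) with P? x
... | yes p = contradiction p ¬p
... | no _  = count-none P? ¬p xs

module Fibres {A B : Set} (_≟_ : DecidableEquality B) (f : A → B) (xs : List A) where

  open DecMembership _≟_ using () renaming (_∈?_ to _∈ˡ?_)

  fibre : B → ℕ
  fibre z = count (λ x → f x ≟ z) xs

  -- A union bound over the fibres. As `ys` may repeat entries, `new?` separates off what is already
  -- counted for `y`.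
  count-image≤ : (K : ℕ) (ys : List B) → (∀ z → fibre z ≤ K) → count (λ x → f x ∈ˡ? ys) xs ≤ length ys * K
  count-image≤ K [] _ = ≤-reflexive (count-none (λ x → f x ∈ˡ? []) (λ ()) xs)
  count-image≤ K (y ∷ ys) h = begin
    count (λ x → f x ∈ˡ? (y ∷ ys)) xs
      ≡⟨ count-⊎ (λ x → f x ≟ y) new? (λ x → f x ∈ˡ? (y ∷ ys)) cases here (there ∘ proj₁) (λ p q → proj₂ q p) xs ⟩
    fibre y + count new? xs
      ≤⟨ +-mono-≤ (h y) (≤-trans (count-⊆ new? (λ x → f x ∈ˡ? ys) proj₁ xs) (count-image≤ K ys h)) ⟩
    K + length ys * K ∎
    where
    open ≤-Reasoning
    new? : Decidable (λ x → f x ∈ˡ ys × f x ≢ y)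
    new? x = (f x ∈ˡ? ys) ×-dec ¬? (f x ≟ y)
    cases : ∀ {x} → f x ∈ˡ y ∷ ys → f x ≡ y ⊎ (f x ∈ˡ ys × f x ≢ y)
    cases (here eq) = inj₁ eq
    cases {x} (there fx∈) with f x ≟ y
    ... | yes eq = inj₁ eq
    ... | no neq = inj₂ (fx∈ , neq)

  -- Adds up equal fibres; for the map sending `g` to `act g b` this is the double count behind
  -- orbit-stabiliser.
  count-image≡ : {P : B → Set} (P? : Decidable P) (s : ℕ) (ys : List B) → Unique ys →
    (∀ {z} → z ∈ˡ ys → fibre z ≡ s) →
    count (λ x → P? (f x) ×-dec (f x ∈ˡ? ys)) xs ≡ count P? ys * s
  count-image≡ P? s [] _ _ = count-none (λ x → P? (f x) ×-dec (f x ∈ˡ? [])) (λ ()) xs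
  count-image≡ {P} P? s (y ∷ ys) u@(_ ∷ u′) h = begin
    count (λ x → P? (f x) ×-dec (f x ∈ˡ? (y ∷ ys))) xs
      ≡⟨ count-⊎ first? rest? (λ x → P? (f x) ×-dec (f x ∈ˡ? (y ∷ ys)))
           (λ { (p , here eq) → inj₁ (p , eq) ; (p , there i) → inj₂ (p , i) })
           (λ { (p , eq) → p , here eq }) (λ { (p , i) → p , there i })
           (λ { (_ , refl) (_ , i) → Unique.Unique[x∷xs]⇒x∉xs u i }) xs ⟩
    count first? xs + count rest? xs
      ≡⟨ cong (count first? xs +_) (count-image≡ P? s ys u′ (h ∘ there)) ⟩
    count first? xs + count P? ys * s
      ≡⟨ head ⟩
    count P? (y ∷ ys) * s ∎
    where
    open ≡-Reasoning
    first? : Decidable (λ x → P (f x) × f x ≡ y)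
    first? x = P? (f x) ×-dec (f x ≟ y)
    rest? : Decidable (λ x → P (f x) × f x ∈ˡ ys)
    rest? x = P? (f x) ×-dec (f x ∈ˡ? ys)
    head : count first? xs + count P? ys * s ≡ count P? (y ∷ ys) * s
    head with P? y
    ... | yes p = cong (_+ count P? ys * s) (trans (count-≐ first? (λ x → f x ≟ y) proj₂ (λ { refl → p , refl }) xs) (h (here refl)))
    ... | no ¬p = cong (_+ count P? ys * s) (count-none first? (λ { (p , refl) → ¬p p }) xs)

-- Choosing sublists with prescribed sums

-- The items left over are kept because distinctness of the chosen blocks is inherited, through the
-- permutation, from the whole family.
record Split {A : Set} (xs : List A) (Good : List A → Set) : Set where
  constructor split
  field
    chosen rest : List A
    perm        : xs ↭ chosen ++ rest
    good        : Good chosen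

module _ {A : Set} where

  split-all : (xs : List A) → Split xs (_≡ xs)
  split-all xs = split xs [] (↭-reflexive (sym (++-identityʳ xs))) refl

  split-none : (xs : List A) → Split xs (_≡ [])
  split-none xs = split [] xs ↭-refl refl

  -- Turns the chosen list itself into the property, so that later steps can match on it with
  -- `refl`.
  split-exact : {G : List A → Set} {xs : List A} (s : Split xs G) → Split xs (_≡ Split.chosen s)
  split-exact (split c r p _) = split c r p refl

  split-map : {G H : List A → Set} {xs : List A} → (∀ {zs} → G zs → H zs) → Split xs G → Split xs H
  split-map h (split c r p g) = split c r p (h g)

  split-++ : {G H K : List A → Set} {xs ys : List A} → (∀ {zs ws} → G zs → H ws → K (zs ++ ws)) →
    Split xs G → Split ys H → Split (xs ++ ys) K
  split-++ {xs = xs} {ys} h (split c r p g) (split c′ r′ p′ g′) = split (c ++ c′) (r ++ r′) perm (h g g′)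
    where
    perm : xs ++ ys ↭ (c ++ c′) ++ (r ++ r′)
    perm = ↭-trans (↭-++⁺ p p′) (↭-trans (↭-reflexive (++-assoc c r (c′ ++ r′)))
      (↭-trans (++⁺ˡ c (shifts r c′)) (↭-reflexive (sym (++-assoc c c′ (r ++ r′))))))

  pick : List Bool → List A → List A
  pick (true  ∷ bs) (x ∷ xs) = x ∷ pick bs xs
  pick (false ∷ bs) (x ∷ xs) = pick bs xs
  pick _            _        = []

  split-pick : (bs : List Bool) (xs : List A) → Split xs (_≡ pick bs xs)
  split-pick []           xs       = split-none xs
  split-pick (true  ∷ bs) []       = split-none []
  split-pick (false ∷ bs) []       = split-none []
  split-pick (true  ∷ bs) (x ∷ xs) with split-pick bs xs
  ... | split c r p refl = split (x ∷ c) r (↭-prep x p) refl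
  split-pick (false ∷ bs) (x ∷ xs) with split-pick bs xs
  ... | split c r p refl = split c (x ∷ r) (↭-trans (↭-prep x p) (↭-sym (shift x c r))) refl

module Selection {A : Set} (x y : A → ℕ) where

  X Y : List A → ℕ
  X = sum ∘ map x
  Y = sum ∘ map y

  sum-map-++ : (f : A → ℕ) (zs ws : List A) → sum (map f (zs ++ ws)) ≡ sum (map f zs) + sum (map f ws)
  sum-map-++ f zs ws = trans (cong sum (map-++ f zs ws)) (sum-++ (map f zs) (map f ws))

  sum-map-↭ : (f : A → ℕ) {zs ws : List A} → zs ↭ ws → sum (map f zs) ≡ sum (map f ws)
  sum-map-↭ f p = sum-↭ (↭-map⁺ f p)

  X-chosen≤ : ∀ {zs G} (s : Split zs G) → X (Split.chosen s) ≤ X zs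
  X-chosen≤ (split c r p _) = ≤-trans (m≤m+n (X c) (X r)) (≤-reflexive (sym (trans (sum-map-↭ x p) (sum-map-++ x c r))))

  Balanced : ℕ → List A → Set
  Balanced n zs = X zs ≡ n × Y zs ≡ n

  balanced-++ : ∀ {m n zs ws} → Balanced m zs → Balanced n ws → Balanced (m + n) (zs ++ ws)
  balanced-++ {zs = zs} {ws} (p , q) (p′ , q′) =
    trans (sum-map-++ x zs ws) (cong₂ _+_ p p′) , trans (sum-map-++ y zs ws) (cong₂ _+_ q q′)

  Covers : List A → ℕ → ℕ → Set
  Covers xs l h = ∀ n → l ≤ n → n ≤ h → Split xs (Balanced n)

  -- The intervals [l, h] without `b` and [l + w, h + w] with `b` leave no gap when l + w ≤ h + 1.
  covers-bundle : ∀ {xs l h w} (b : List A) → Balanced w b → l + w ≤ suc h →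
    Covers xs l h → Covers (xs ++ b) l (h + w)
  covers-bundle {xs} {l} {h} {w} b bal fits cov n l≤n n≤h+w with n ≤? h
  ... | yes n≤h = split-++ (λ { {zs} g refl → subst (Balanced n) (sym (++-identityʳ zs)) g }) (cov n l≤n n≤h) (split-none b)
  ... | no n≰h  = split-++ (λ { {zs} g refl → subst (λ k → Balanced k (zs ++ b)) (m∸n+n≡m w≤n) (balanced-++ {zs = zs} {b} g bal) })
                    (cov (n ∸ w) l≤ ≤h) (split-all b)
    where
    l+w≤n : l + w ≤ n
    l+w≤n = ≤-trans fits (≰⇒> n≰h)
    w≤n : w ≤ n
    w≤n = ≤-trans (m≤n+m w l) l+w≤n
    l≤ : l ≤ n ∸ w
    l≤ = subst (_≤ n ∸ w) (m+n∸n≡m l w) (∸-monoˡ-≤ w l+w≤n)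
    ≤h : n ∸ w ≤ h
    ≤h = subst (n ∸ w ≤_) (m+n∸n≡m h w) (∸-monoˡ-≤ w n≤h+w)

  Fits : ℕ → ℕ → List (List A) → Set
  Fits l h []       = ⊤
  Fits l h (b ∷ bs) = Y b ≡ X b × l + X b ≤ suc h × Fits l (h + X b) bs

  fits? : ∀ l h bs → Dec (Fits l h bs)
  fits? l h []       = yes tt
  fits? l h (b ∷ bs) = (Y b ≟ X b) ×-dec (l + X b ≤? suc h) ×-dec fits? l (h + X b) bs

  covers-bundles : ∀ {xs l h} bs → Fits l h bs → Covers xs l h → Covers (xs ++ concat bs) l (h + X (concat bs))
  covers-bundles {xs} {l} {h} [] _ cov =
    subst₂ (λ zs k → Covers zs l k) (sym (++-identityʳ xs)) (sym (+-identityʳ h)) cov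
  covers-bundles {xs} {l} {h} (b ∷ bs) (eq , fit , fits) cov =
    subst₂ (λ zs k → Covers zs l k) (++-assoc xs b (concat bs))
      (trans (+-assoc h (X b) _) (cong (h +_) (sym (sum-map-++ x b (concat bs)))))
      (covers-bundles bs fits (covers-bundle b (refl , eq) fit cov))

  -- The signed equation X - Y = u - N without subtraction. When N is the sum of y - x over the
  -- items with x < y, the least possible imbalance corresponds to u = 0.
  Offset : ℕ → ℕ → List A → Set
  Offset N u zs = X zs + N ≡ Y zs + u

  Covers± : List A → ℕ → ℕ → ℕ → Set
  Covers± xs N l h = ∀ u → l ≤ u → u ≤ h → Split xs (Offset N u)

  -- Choosing an item with x > y raises u; for an item with x < y it is omitting it that raises u.
  covers±-item : ∀ {xs N l h} a → l + ((x a ∸ y a) + (y a ∸ x a)) ≤ suc h → Covers± xs N l h →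
    Covers± (xs ++ [ a ]) (N + (y a ∸ x a)) l (h + ((x a ∸ y a) + (y a ∸ x a)))
  covers±-item {xs} {N} {l} {h} a fits cov u l≤u u≤ with ≤-total (y a) (x a) | u ≤? h
  ... | inj₁ y≤x | yes u≤h rewrite m≤n⇒m∸n≡0 y≤x | +-identityʳ N =
    split-++ (λ { {zs} g refl → subst (Offset N u) (sym (++-identityʳ zs)) g }) (cov u l≤u u≤h) (split-none [ a ])
  ... | inj₁ y≤x | no u≰h rewrite m≤n⇒m∸n≡0 y≤x | +-identityʳ N | +-identityʳ (x a ∸ y a) =
    split-++ (λ { {zs} g refl → raise zs g }) (cov (u ∸ w) l≤ ≤h) (split-all [ a ])
    where
    w = x a ∸ y a
    l+w≤u : l + w ≤ u
    l+w≤u = ≤-trans fits (≰⇒> u≰h)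
    w≤u : w ≤ u
    w≤u = ≤-trans (m≤n+m w l) l+w≤u
    l≤ : l ≤ u ∸ w
    l≤ = subst (_≤ u ∸ w) (m+n∸n≡m l w) (∸-monoˡ-≤ w l+w≤u)
    ≤h : u ∸ w ≤ h
    ≤h = subst (u ∸ w ≤_) (m+n∸n≡m h w) (∸-monoˡ-≤ w u≤)
    shuffle : ∀ p q r s → (p + (q + r)) + s ≡ (p + s) + (q + r)
    shuffle = solve-∀
    shuffle′ : ∀ p q r s → (p + q) + (r + s) ≡ (p + r) + (q + s)
    shuffle′ = solve-∀
    raise : ∀ zs → Offset N (u ∸ w) zs → Offset N u (zs ++ [ a ])
    raise zs g = begin
      X (zs ++ [ a ]) + N            ≡⟨ cong (_+ N) (sum-map-++ x zs [ a ]) ⟩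
      (X zs + (x a + 0)) + N         ≡⟨ shuffle (X zs) (x a) 0 N ⟩
      (X zs + N) + (x a + 0)         ≡⟨ cong₂ _+_ g (trans (+-identityʳ (x a)) (sym (m+[n∸m]≡n y≤x))) ⟩
      (Y zs + (u ∸ w)) + (y a + w)   ≡⟨ shuffle′ (Y zs) (u ∸ w) (y a) w ⟩
      (Y zs + y a) + ((u ∸ w) + w)   ≡⟨ cong₂ _+_ (cong (Y zs +_) (sym (+-identityʳ (y a)))) (m∸n+n≡m w≤u) ⟩
      (Y zs + (y a + 0)) + u         ≡⟨ cong (_+ u) (sum-map-++ y zs [ a ]) ⟨
      Y (zs ++ [ a ]) + u            ∎
      where open ≡-Reasoning
  ... | inj₂ x≤y | yes u≤h rewrite m≤n⇒m∸n≡0 x≤y =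
    split-++ (λ { {zs} g refl → keep zs g }) (cov u l≤u u≤h) (split-all [ a ])
    where
    w = y a ∸ x a
    shuffle : ∀ p q r s → (p + (q + 0)) + (r + s) ≡ (p + r) + (q + s)
    shuffle = solve-∀
    shuffle′ : ∀ p q r → (p + q) + r ≡ (p + (r + 0)) + q
    shuffle′ = solve-∀
    keep : ∀ zs → Offset N u zs → Offset (N + w) u (zs ++ [ a ])
    keep zs g = begin
      X (zs ++ [ a ]) + (N + w)      ≡⟨ cong (_+ (N + w)) (sum-map-++ x zs [ a ]) ⟩
      (X zs + (x a + 0)) + (N + w)   ≡⟨ shuffle (X zs) (x a) N w ⟩
      (X zs + N) + (x a + w)         ≡⟨ cong₂ _+_ g (m+[n∸m]≡n x≤y) ⟩
      (Y zs + u) + y a               ≡⟨ shuffle′ (Y zs) u (y a) ⟩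
      (Y zs + (y a + 0)) + u         ≡⟨ cong (_+ u) (sum-map-++ y zs [ a ]) ⟨
      Y (zs ++ [ a ]) + u            ∎
      where open ≡-Reasoning
  ... | inj₂ x≤y | no u≰h rewrite m≤n⇒m∸n≡0 x≤y =
    split-++ (λ { {zs} g refl → subst (Offset (N + w) u) (sym (++-identityʳ zs)) (raise zs g) }) (cov (u ∸ w) l≤ ≤h) (split-none [ a ])
    where
    w = y a ∸ x a
    l+w≤u : l + w ≤ u
    l+w≤u = ≤-trans fits (≰⇒> u≰h)
    w≤u : w ≤ u
    w≤u = ≤-trans (m≤n+m w l) l+w≤u
    l≤ : l ≤ u ∸ w
    l≤ = subst (_≤ u ∸ w) (m+n∸n≡m l w) (∸-monoˡ-≤ w l+w≤u)
    ≤h : u ∸ w ≤ h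
    ≤h = subst (u ∸ w ≤_) (m+n∸n≡m h w) (∸-monoˡ-≤ w u≤)
    raise : ∀ zs → Offset N (u ∸ w) zs → Offset (N + w) u zs
    raise zs g = begin
      X zs + (N + w)         ≡⟨ +-assoc (X zs) N w ⟨
      (X zs + N) + w         ≡⟨ cong (_+ w) g ⟩
      (Y zs + (u ∸ w)) + w   ≡⟨ +-assoc (Y zs) (u ∸ w) w ⟩
      Y zs + ((u ∸ w) + w)   ≡⟨ cong (Y zs +_) (m∸n+n≡m w≤u) ⟩
      Y zs + u               ∎
      where open ≡-Reasoning

  -- One of the two truncated differences is always 0, so their sum is |x - y|: `offset` grows only
  -- by items with x < y, `height` by all.
  offset height : ℕ → List A → ℕ
  offset N []       = N
  offset N (a ∷ as) = offset (N + (y a ∸ x a)) as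
  height h []       = h
  height h (a ∷ as) = height (h + ((x a ∸ y a) + (y a ∸ x a))) as

  Fits± : ℕ → ℕ → List A → Set
  Fits± l h []       = ⊤
  Fits± l h (a ∷ as) = l + ((x a ∸ y a) + (y a ∸ x a)) ≤ suc h × Fits± l (h + ((x a ∸ y a) + (y a ∸ x a))) as

  fits±? : ∀ l h as → Dec (Fits± l h as)
  fits±? l h []       = yes tt
  fits±? l h (a ∷ as) = (_ ≤? suc h) ×-dec fits±? l _ as

  covers±-items : ∀ {xs N l h} as → Fits± l h as → Covers± xs N l h → Covers± (xs ++ as) (offset N as) l (height h as)
  covers±-items {xs} {N} {l} {h} [] _ cov = subst (λ zs → Covers± zs N l h) (sym (++-identityʳ xs)) cov
  covers±-items {xs} {l = l} (a ∷ as) (fit , fits) cov =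
    subst (λ zs → Covers± zs _ l _) (++-assoc xs [ a ] as) (covers±-items as fits (covers±-item a fit cov))

  find-< : (zs : List A) → X zs < Y zs → ∃₂ λ a ws → zs ↭ a ∷ ws × x a < y a
  find-< (a ∷ zs) lt with x a <? y a
  ... | yes x<y = a , zs , ↭-refl , x<y
  ... | no x≮y with find-< zs (+-cancelˡ-< (x a) (X zs) (Y zs) (<-≤-trans lt (+-monoˡ-≤ (Y zs) (≮⇒≥ x≮y))))
  ... | b , ws , p , x<y = b , a ∷ ws , ↭-trans (↭-prep a p) (↭-swap a b ↭-refl) , x<y

  find-≥ : (zs : List A) → Y zs ≤ X zs → zs ≡ [] ⊎ (∃₂ λ a ws → zs ↭ a ∷ ws × y a ≤ x a)
  find-≥ [] _ = inj₁ refl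
  find-≥ (a ∷ zs) le with y a ≤? x a
  ... | yes y≤x = inj₂ (a , zs , ↭-refl , y≤x)
  ... | no y≰x with find-≥ zs (<⇒≤ (+-cancelˡ-< (y a) (Y zs) (X zs) (≤-<-trans le (+-monoˡ-< (X zs) (≰⇒> y≰x)))))
  ... | inj₁ refl = contradiction (subst₂ _≤_ (+-identityʳ (y a)) (+-identityʳ (x a)) le) y≰x
  ... | inj₂ (b , ws , p , y≤x) = inj₂ (b , a ∷ ws , ↭-trans (↭-prep a p) (↭-swap a b ↭-refl) , y≤x)

  module Greedy (bx by : ℕ) (x≤bx : ∀ a → x a ≤ bx) (y≤by : ∀ a → y a ≤ by) (Np Nm τ : ℕ)
    (0<bx : 0 < bx) (bx≤Np : bx ≤ Np) (pool : List A) (total : X pool + Np ≡ Y pool + Nm) (τ≤ : τ ≤ X pool) where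

    -- The chosen part has imbalance X - Y = Nm - u. One step changes u by at most `by` upwards from
    -- below Np, or at most `bx` downwards from Np or above, which explains the window around Np.
    Near : List A → Set
    Near zs = ∃ λ u → X zs + u ≡ Y zs + Nm × Np ≤ u + bx × u ≤ Np + by × X zs ≤ τ × τ < X zs + bx

    -- The chosen part has X − Y = Nm − u and the remaining part has X − Y = u − Np, so the
    -- latter contains an item that moves u towards Np.
    loop : ∀ n S R u → n ≡ length R → pool ↭ S ++ R → X S + u ≡ Y S + Nm → Np ≤ u + bx → u ≤ Np + by → X S ≤ τ →
      Split pool Near
    loop n S R u len p eq lo hi X≤τ with τ <? X S + bx
    ... | yes τ< = split S R p (u , eq , lo , hi , X≤τ , τ<)
    ... | no τ≮ = continue n len
      where
      below : X S + bx ≤ τ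
      below = ≮⇒≥ τ≮
      restEq : X R + Np ≡ Y R + u
      restEq = +-cancelˡ-≡ (X S) _ _ (begin
        X S + (X R + Np)   ≡⟨ +-assoc (X S) (X R) Np ⟨
        (X S + X R) + Np   ≡⟨ cong (_+ Np) (trans (sum-map-↭ x p) (sum-map-++ x S R)) ⟨
        X pool + Np        ≡⟨ total ⟩
        Y pool + Nm        ≡⟨ cong (_+ Nm) (trans (sum-map-↭ y p) (sum-map-++ y S R)) ⟩
        (Y S + Y R) + Nm   ≡⟨ shuffle (Y S) (Y R) Nm ⟩
        (Y S + Nm) + Y R   ≡⟨ cong (_+ Y R) eq ⟨
        (X S + u) + Y R    ≡⟨ shuffle′ (X S) u (Y R) ⟩
        X S + (Y R + u)    ∎)
        where
        open ≡-Reasoning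
        shuffle : ∀ a b c → (a + b) + c ≡ (a + c) + b
        shuffle = solve-∀
        shuffle′ : ∀ a b c → (a + b) + c ≡ a + (c + b)
        shuffle′ = solve-∀
      move : ∀ {a ws} → R ↭ a ∷ ws → pool ↭ (a ∷ S) ++ ws
      move {a} {ws} q = ↭-trans p (↭-trans (++⁺ˡ S q) (shift a S ws))
      X≤τ′ : ∀ a → x a + X S ≤ τ
      X≤τ′ a = ≤-trans (≤-trans (+-monoˡ-≤ (X S) (x≤bx a)) (≤-reflexive (+-comm bx (X S)))) below
      continue : ∀ n → n ≡ length R → Split pool Near
      continue n len with u <? Np
      continue n len | yes u<Np with find-< R (+-cancelʳ-< Np (X R) (Y R) (subst (_< Y R + Np) (sym restEq) (+-monoʳ-< (Y R) u<Np)))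
      continue zero len | yes u<Np | a , ws , q , x<y with () ← trans len (↭-length q)
      continue (suc n) len | yes u<Np | a , ws , q , x<y =
        loop n (a ∷ S) ws (u + w) (ℕ.suc-injective (trans len (↭-length q))) (move q) eq′
          (≤-trans lo (+-monoˡ-≤ bx (m≤m+n u w))) (+-mono-≤ (<⇒≤ u<Np) (≤-trans (m∸n≤m (y a) (x a)) (y≤by a))) (X≤τ′ a)
        where
        w = y a ∸ x a
        shuffle : ∀ p q r s → (p + q) + (r + s) ≡ (q + r) + (p + s)
        shuffle = solve-∀
        shuffle′ : ∀ p q r → (p + q) + r ≡ (r + p) + q
        shuffle′ = solve-∀
        eq′ : (x a + X S) + (u + w) ≡ (y a + Y S) + Nm
        eq′ = begin
          (x a + X S) + (u + w) ≡⟨ shuffle (x a) (X S) u w ⟩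
          (X S + u) + (x a + w) ≡⟨ cong₂ _+_ eq (m+[n∸m]≡n (<⇒≤ x<y)) ⟩
          (Y S + Nm) + y a      ≡⟨ shuffle′ (Y S) Nm (y a) ⟩
          (y a + Y S) + Nm      ∎
          where open ≡-Reasoning
      continue n len | no u≮Np with find-≥ R (+-cancelʳ-≤ Np (Y R) (X R) (subst (Y R + Np ≤_) (sym restEq) (+-monoʳ-≤ (Y R) (≮⇒≥ u≮Np))))
      -- With nothing left, the whole pool is chosen and still X pool < τ, against `τ≤`.
      continue n len | no u≮Np | inj₁ refl = contradiction (≤-trans below (≤-trans τ≤ (≤-reflexive X≡))) (<⇒≱ (m<m+n (X S) 0<bx))
        where
        X≡ : X pool ≡ X S
        X≡ = trans (sum-map-↭ x p) (cong X (++-identityʳ S))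
      continue zero len | no u≮Np | inj₂ (a , ws , q , y≤x) with () ← trans len (↭-length q)
      continue (suc n) len | no u≮Np | inj₂ (a , ws , q , y≤x) =
        loop n (a ∷ S) ws (u ∸ w) (ℕ.suc-injective (trans len (↭-length q))) (move q) eq′
          (≤-trans Np≤u (≤-trans (≤-reflexive (sym (m∸n+n≡m w≤u))) (+-monoʳ-≤ (u ∸ w) w≤bx)))
          (≤-trans (m∸n≤m u w) hi) (X≤τ′ a)
        where
        w = x a ∸ y a
        Np≤u : Np ≤ u
        Np≤u = ≮⇒≥ u≮Np
        w≤bx : w ≤ bx
        w≤bx = ≤-trans (m∸n≤m (x a) (y a)) (x≤bx a)
        w≤u : w ≤ u
        w≤u = ≤-trans w≤bx (≤-trans bx≤Np Np≤u)
        shuffle : ∀ p q r s → ((p + q) + r) + s ≡ p + (r + (s + q))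
        shuffle = solve-∀
        eq′ : (x a + X S) + (u ∸ w) ≡ (y a + Y S) + Nm
        eq′ = begin
          (x a + X S) + (u ∸ w)       ≡⟨ cong (λ k → (k + X S) + (u ∸ w)) (sym (m+[n∸m]≡n y≤x)) ⟩
          ((y a + w) + X S) + (u ∸ w) ≡⟨ shuffle (y a) w (X S) (u ∸ w) ⟩
          y a + (X S + ((u ∸ w) + w)) ≡⟨ cong (λ k → y a + (X S + k)) (m∸n+n≡m w≤u) ⟩
          y a + (X S + u)             ≡⟨ cong (y a +_) eq ⟩
          y a + (Y S + Nm)            ≡⟨ +-assoc (y a) (Y S) Nm ⟨
          (y a + Y S) + Nm            ∎
          where open ≡-Reasoning

    greedy : Np ≤ Nm + bx → Nm ≤ Np + by → Split pool Near
    greedy lo hi = loop (length pool) [] pool Nm refl ↭-refl refl lo hi z≤n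

  -- The bounds on `lc` and `hc` put the greedy window [Np - bx, Np + by] inside the range of `C`;
  -- the next two put its initial value u = Nm inside the window. `room` says that `F` can absorb
  -- all uncertainty in X: the correctors may contribute anything up to X C, and the greedy part
  -- stops less than `bx` short of its target.
  module Combine {C F : List A} {Nm lc hc lf hf : ℕ} (covC : Covers± C Nm lc hc) (covF : Covers F lf hf)
    (bx by : ℕ) (x≤bx : ∀ a → x a ≤ bx) (y≤by : ∀ a → y a ≤ by) (Np : ℕ)
    (0<bx : 0 < bx) (bx≤Np : bx ≤ Np) (lc+bx≤Np : lc + bx ≤ Np) (Np+by≤hc : Np + by ≤ hc)
    (Np≤Nm+bx : Np ≤ Nm + bx) (Nm≤Np+by : Nm ≤ Np + by) (room : (X C + lf) + bx ≤ hf) where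

    -- The pool is used up greedily until about m is reached, C then repairs the imbalance
    -- and F supplies what is missing.
    combine : ∀ pool → X pool + Np ≡ Y pool + Nm → ∀ m → X C + lf ≤ m → m ≤ X pool →
      Split ((C ++ F) ++ pool) (Balanced m)
    combine pool total m below m≤ = assemble (greedy Np≤Nm+bx Nm≤Np+by)
      where
      τ : ℕ
      τ = m ∸ (X C + lf)
      τ+≡m : τ + (X C + lf) ≡ m
      τ+≡m = m∸n+n≡m below
      open Greedy bx by x≤bx y≤by Np Nm τ 0<bx bx≤Np pool total (≤-trans (m∸n≤m m (X C + lf)) m≤) using (Near; greedy)
      assemble : Split pool Near → Split ((C ++ F) ++ pool) (Balanced m)
      assemble spP@(split S _ _ (u , S-eq , lo , hi , X≤τ , τ<)) =
        split-++ {G = _≡ K ++ L} (λ { refl refl → balanced }) (split-++ (λ { refl refl → refl }) (split-exact spC) (split-exact spF)) (split-exact spP)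
        where
        spC : Split C (Offset Nm u)
        spC = covC u (+-cancelʳ-≤ bx lc u (≤-trans lc+bx≤Np lo)) (≤-trans hi Np+by≤hc)
        K : List A
        K = Split.chosen spC
        n : ℕ
        n = X K + X S
        n-Y : n ≡ Y K + Y S
        -- The imbalances u - Nm of `K` and Nm - u of `S` cancel.
        n-Y = +-cancelʳ-≡ (Nm + u) _ _ (begin
          (X K + X S) + (Nm + u)  ≡⟨ interchange (X K) (X S) Nm u ⟩
          (X K + Nm) + (X S + u)  ≡⟨ cong₂ _+_ (Split.good spC) S-eq ⟩
          (Y K + u) + (Y S + Nm)  ≡⟨ interchange′ (Y K) u (Y S) Nm ⟩
          (Y K + Y S) + (Nm + u)  ∎)
          where
          open ≡-Reasoning
          interchange : ∀ a b c d → (a + b) + (c + d) ≡ (a + c) + (b + d)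
          interchange = solve-∀
          interchange′ : ∀ a b c d → (a + b) + (c + d) ≡ (a + c) + (d + b)
          interchange′ = solve-∀
        lf+n≤m : lf + n ≤ m
        lf+n≤m = begin
          lf + (X K + X S)   ≤⟨ +-monoʳ-≤ lf (+-mono-≤ (X-chosen≤ spC) X≤τ) ⟩
          lf + (X C + τ)     ≡⟨ rotate lf (X C) τ ⟩
          τ + (X C + lf)     ≡⟨ τ+≡m ⟩
          m                  ∎
          where
          open ≤-Reasoning
          rotate : ∀ a b c → a + (b + c) ≡ c + (b + a)
          rotate = solve-∀
        n≤m : n ≤ m
        n≤m = ≤-trans (m≤n+m n lf) lf+n≤m
        m≤n+hf : m ≤ n + hf
        m≤n+hf = begin
          m                         ≡⟨ τ+≡m ⟨
          τ + (X C + lf)            ≤⟨ +-monoˡ-≤ (X C + lf) (<⇒≤ τ<) ⟩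
          (X S + bx) + (X C + lf)   ≡⟨ rotate (X S) bx (X C + lf) ⟩
          X S + ((X C + lf) + bx)   ≤⟨ +-mono-≤ (m≤n+m (X S) (X K)) room ⟩
          n + hf                    ∎
          where
          open ≤-Reasoning
          rotate : ∀ a b c → (a + b) + c ≡ a + (c + b)
          rotate = solve-∀
        spF : Split F (Balanced (m ∸ n))
        spF = covF (m ∸ n) (m+n≤o⇒m≤o∸n lf lf+n≤m) (m≤n+o⇒m∸n≤o m n m≤n+hf)
        L : List A
        L = Split.chosen spF
        collect : (f : A → ℕ) → sum (map f L) ≡ m ∸ n → sum (map f K) + sum (map f S) ≡ n → sum (map f ((K ++ L) ++ S)) ≡ m
        collect f eq eq′ = begin
          sum (map f ((K ++ L) ++ S))                      ≡⟨ sum-map-++ f (K ++ L) S ⟩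
          sum (map f (K ++ L)) + sum (map f S)             ≡⟨ cong (_+ sum (map f S)) (sum-map-++ f K L) ⟩
          (sum (map f K) + sum (map f L)) + sum (map f S)  ≡⟨ rotate (sum (map f K)) (sum (map f L)) (sum (map f S)) ⟩
          (sum (map f K) + sum (map f S)) + sum (map f L)  ≡⟨ cong₂ _+_ eq′ eq ⟩
          n + (m ∸ n)                                      ≡⟨ m+[n∸m]≡n n≤m ⟩
          m                                                ∎
          where
          open ≡-Reasoning
          rotate : ∀ a b c → (a + b) + c ≡ (a + c) + b
          rotate = solve-∀
        balanced : Balanced m ((K ++ L) ++ S)
        balanced = collect x (proj₁ (Split.good spF)) refl , collect y (proj₂ (Split.good spF)) (sym n-Y)

-- Subsets of a finite set

_≟ˢ_ : ∀ {n} → DecidableEquality (Subset n)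
_≟ˢ_ = Vec-≡-dec Bool._≟_

members : ∀ {n} → Subset n → List (Fin n)
members []            = []
members (inside ∷ p)  = zero ∷ map suc (members p)
members (outside ∷ p) = map suc (members p)

length-members : ∀ {n} (p : Subset n) → length (members p) ≡ ∣ p ∣
length-members []            = refl
length-members (inside ∷ p)  = cong suc (trans (length-map suc (members p)) (length-members p))
length-members (outside ∷ p) = trans (length-map suc (members p)) (length-members p)

∈-members⁺ : ∀ {n} {p : Subset n} {x} → x ∈ p → x ∈ˡ members p
∈-members⁺ {p = inside ∷ p}  here      = here refl
∈-members⁺ {p = inside ∷ p}  (there i) = there (∈-map⁺ suc (∈-members⁺ i))
∈-members⁺ {p = outside ∷ p} (there i) = ∈-map⁺ suc (∈-members⁺ i)

∈-members⁻ : ∀ {n} {p : Subset n} {x} → x ∈ˡ members p → x ∈ p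
∈-members⁻ {p = inside ∷ p}  (here refl) = here
∈-members⁻ {p = inside ∷ p}  (there i) with ∈-map⁻ suc i
... | _ , j , refl = there (∈-members⁻ j)
∈-members⁻ {p = outside ∷ p} i with ∈-map⁻ suc i
... | _ , j , refl = there (∈-members⁻ j)

members-unique : ∀ {n} (p : Subset n) → Unique (members p)
members-unique []            = []
members-unique (inside ∷ p)  = All.map⁺ (All.tabulate λ _ ()) ∷ Unique.map⁺ suc-injective (members-unique p)
members-unique (outside ∷ p) = Unique.map⁺ suc-injective (members-unique p)

indicator : ∀ {n} → Subset n → Fin n → ℕ
indicator p i = if lookup p i then 1 else 0

∣∣≡Σ : ∀ {n} (p : Subset n) → ∣ p ∣ ≡ Σᶠ (indicator p)
∣∣≡Σ []            = refl
∣∣≡Σ (inside ∷ p)  = cong suc (∣∣≡Σ p)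
∣∣≡Σ (outside ∷ p) = ∣∣≡Σ p

both? : ∀ {n} (e f : Fin n) → Decidable (λ c → e ∈ c × f ∈ c)
both? e f c = (e ∈? c) ×-dec (f ∈? c)

pairCount : ∀ {n} → Fin n → Fin n → List (Subset n) → ℕ
pairCount e f = count (both? e f)

-- A two-element set is listed by `members` as e, f, and a block contains it exactly when it
-- contains both.
simpleDesign : ∀ {v k lam} (B : List (Subset v)) → Unique B → All (λ b → ∣ b ∣ ≡ k) B →
  (∀ e f → e ≢ f → pairCount e f B ≡ lam) → SimpleDesign 2 v k lam
simpleDesign {v} {lam = lam} B u size h = B , u , size , regular
  where
  regular : (T : Subset v) → ∣ T ∣ ≡ 2 → blocksContaining T B ≡ lam
  regular T ∣T∣≡2 with members T in eq | trans (length-members T) ∣T∣≡2 | members-unique T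
  ... | e ∷ f ∷ [] | refl | (e≢f ∷ _) ∷ _ = trans (count-≐ (T ⊆?_) (both? e f) to from B) (h e f e≢f)
    where
    to : ∀ {c} → T ⊆ c → e ∈ c × f ∈ c
    to T⊆c = T⊆c (∈-members⁻ (subst (e ∈ˡ_) (sym eq) (here refl))) , T⊆c (∈-members⁻ (subst (f ∈ˡ_) (sym eq) (there (here refl))))
    from : ∀ {c} → e ∈ c × f ∈ c → T ⊆ c
    from (e∈c , f∈c) x∈T with subst (_ ∈ˡ_) eq (∈-members⁺ x∈T)
    ... | here refl         = e∈c
    ... | there (here refl) = f∈c

-- Subsets of a given size and the number of those that contain a given set

subsets : (n k : ℕ) → List (Subset n)
subsets zero    zero    = [] ∷ []
subsets zero    (suc k) = []
subsets (suc n) zero    = map (outside ∷_) (subsets n zero)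
subsets (suc n) (suc k) = map (inside ∷_) (subsets n k) ++ map (outside ∷_) (subsets n (suc k))

∷-injectiveʳ : ∀ {n} {s : Bool} {p q : Subset n} → s ∷ p ≡ s ∷ q → p ≡ q
∷-injectiveʳ refl = refl

subsets-unique : ∀ n k → Unique (subsets n k)
subsets-unique zero    zero    = [] ∷ []
subsets-unique zero    (suc k) = []
subsets-unique (suc n) zero    = Unique.map⁺ ∷-injectiveʳ (subsets-unique n zero)
subsets-unique (suc n) (suc k) = Unique.++⁺ (Unique.map⁺ ∷-injectiveʳ (subsets-unique n k)) (Unique.map⁺ ∷-injectiveʳ (subsets-unique n (suc k))) disjoint
  where
  disjoint : ∀ {z} → ¬ (z ∈ˡ map (inside ∷_) (subsets n k) × z ∈ˡ map (outside ∷_) (subsets n (suc k)))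
  disjoint (i , j) with ∈-map⁻ (inside ∷_) i | ∈-map⁻ (outside ∷_) j
  ... | _ , _ , refl | _ , _ , ()

∈-subsets⁺ : ∀ {n k} (p : Subset n) → ∣ p ∣ ≡ k → p ∈ˡ subsets n k
∈-subsets⁺ {zero}          []            refl = here refl
∈-subsets⁺ {suc n}         (inside ∷ p)  refl = ∈-++⁺ˡ (∈-map⁺ (inside ∷_) (∈-subsets⁺ p refl))
∈-subsets⁺ {suc n} {zero}  (outside ∷ p) eq   = ∈-map⁺ (outside ∷_) (∈-subsets⁺ p eq)
∈-subsets⁺ {suc n} {suc k} (outside ∷ p) eq   = ∈-++⁺ʳ (map (inside ∷_) (subsets n k)) (∈-map⁺ (outside ∷_) (∈-subsets⁺ p eq))

∈-subsets⁻ : ∀ {n k} {p : Subset n} → p ∈ˡ subsets n k → ∣ p ∣ ≡ k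
∈-subsets⁻ {zero}  {zero} (here refl) = refl
∈-subsets⁻ {suc n} {zero} i with ∈-map⁻ (outside ∷_) i
... | _ , j , refl = ∈-subsets⁻ j
∈-subsets⁻ {suc n} {suc k} i with ∈-++⁻ (map (inside ∷_) (subsets n k)) i
... | inj₁ i′ with ∈-map⁻ (inside ∷_) i′
...   | _ , j , refl = cong suc (∈-subsets⁻ j)
∈-subsets⁻ {suc n} {suc k} i | inj₂ i′ with ∈-map⁻ (outside ∷_) i′
...   | _ , j , refl = ∈-subsets⁻ j

count-map : {A B : Set} {P : B → Set} (P? : Decidable P) (f : A → B) (xs : List A) → count P? (map f xs) ≡ count (P? ∘ f) xs
count-map P? f [] = refl
count-map P? f (x ∷ xs) with P? (f x)
... | yes _ = cong suc (count-map P? f xs)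
... | no _  = count-map P? f xs

count-⊇-suc : ∀ {n} {T : Subset n} {s t : Bool} → (∀ {p} → s ∷ T ⊆ t ∷ p → T ⊆ p) → (∀ {p} → T ⊆ p → s ∷ T ⊆ t ∷ p) →
  ∀ ps → count ((s ∷ T) ⊆?_) (map (t ∷_) ps) ≡ count (T ⊆?_) ps
count-⊇-suc {T = T} {s} {t} to from ps = trans (count-map ((s ∷ T) ⊆?_) (t ∷_) ps) (count-≐ (λ p → (s ∷ T) ⊆? (t ∷ p)) (T ⊆?_) (λ h → to h) (λ h → from h) ps)

count-⊇-none : ∀ {n} {T : Subset n} ps → count ((inside ∷ T) ⊆?_) (map (outside ∷_) ps) ≡ 0
count-⊇-none {T = T} ps = trans (count-map ((inside ∷ T) ⊆?_) (outside ∷_) ps) (count-none (λ p → (inside ∷ T) ⊆? (outside ∷ p)) (λ h → absurd (h here)) ps)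
  where
  absurd : ∀ {n} {p : Subset n} → ¬ (zero ∈ outside ∷ p)
  absurd ()

count-⊇-small : ∀ {n k} (T : Subset n) → k < ∣ T ∣ → count (T ⊆?_) (subsets n k) ≡ 0
count-⊇-small {suc n} {zero}  (inside ∷ T)  lt = count-⊇-none (subsets n zero)
count-⊇-small {suc n} {suc k} (inside ∷ T)  (s≤s lt) = trans (count-++ ((inside ∷ T) ⊆?_) (map (inside ∷_) (subsets n k)) _)
  (cong₂ _+_ (trans (count-⊇-suc drop-∷-⊆ in⊆in (subsets n k)) (count-⊇-small T lt)) (count-⊇-none (subsets n (suc k))))
count-⊇-small {suc n} {zero}  (outside ∷ T) lt = trans (count-⊇-suc drop-∷-⊆ out⊆ (subsets n zero)) (count-⊇-small T lt)
count-⊇-small {suc n} {suc k} (outside ∷ T) lt = trans (count-++ ((outside ∷ T) ⊆?_) (map (inside ∷_) (subsets n k)) _)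
  (cong₂ _+_ (trans (count-⊇-suc drop-∷-⊆ out⊆ (subsets n k)) (count-⊇-small T (<⇒≤ lt))) (trans (count-⊇-suc drop-∷-⊆ out⊆ (subsets n (suc k))) (count-⊇-small T lt)))

-- Induction on the first point. If it lies in `T`, only subsets through it count; otherwise both
-- kinds do, and their numbers add up by Pascal's rule.
count-⊇ : ∀ {n} (T : Subset n) j → count (T ⊆?_) (subsets n (∣ T ∣ + j)) ≡ (n ∸ ∣ T ∣) choose j
count-⊇ [] zero    = refl
count-⊇ [] (suc j) = refl
count-⊇ {suc n} (inside ∷ T) j = trans (count-++ ((inside ∷ T) ⊆?_) (map (inside ∷_) (subsets n (∣ T ∣ + j))) _)
  (trans (cong₂ _+_ (trans (count-⊇-suc drop-∷-⊆ in⊆in (subsets n (∣ T ∣ + j))) (count-⊇ T j)) (count-⊇-none (subsets n (suc (∣ T ∣ + j))))) (+-identityʳ _))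
count-⊇ {suc n} (outside ∷ T) j with ∣ T ∣ + j in eq
count-⊇ {suc n} (outside ∷ T) j | zero with refl ← m+n≡0⇒n≡0 ∣ T ∣ eq =
  trans (count-⊇-suc drop-∷-⊆ out⊆ (subsets n zero)) (trans (cong (λ k → count (T ⊆?_) (subsets n k)) (sym eq)) (count-⊇ T zero))
count-⊇ {suc n} (outside ∷ T) j | suc k = begin
  count ((outside ∷ T) ⊆?_) (subsets (suc n) (suc k))
    ≡⟨ count-++ ((outside ∷ T) ⊆?_) (map (inside ∷_) (subsets n k)) _ ⟩
  count ((outside ∷ T) ⊆?_) (map (inside ∷_) (subsets n k)) + count ((outside ∷ T) ⊆?_) (map (outside ∷_) (subsets n (suc k)))
    ≡⟨ cong₂ _+_ (count-⊇-suc drop-∷-⊆ out⊆ (subsets n k)) (count-⊇-suc drop-∷-⊆ out⊆ (subsets n (suc k))) ⟩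
  count (T ⊆?_) (subsets n k) + count (T ⊆?_) (subsets n (suc k))
    ≡⟨ cong (λ i → count (T ⊆?_) (subsets n k) + count (T ⊆?_) (subsets n i)) eq ⟨
  count (T ⊆?_) (subsets n k) + count (T ⊆?_) (subsets n (∣ T ∣ + j))
    ≡⟨ cong (count (T ⊆?_) (subsets n k) +_) (count-⊇ T j) ⟩
  count (T ⊆?_) (subsets n k) + (n ∸ ∣ T ∣) choose j
    ≡⟨ pascal j eq ⟩
  suc (n ∸ ∣ T ∣) choose j
    ≡⟨ cong (_choose j) (+-∸-assoc 1 (∣p∣≤n T)) ⟨
  (suc n ∸ ∣ T ∣) choose j ∎
  where
  open ≡-Reasoning
  pascal : ∀ j → ∣ T ∣ + j ≡ suc k → count (T ⊆?_) (subsets n k) + (n ∸ ∣ T ∣) choose j ≡ suc (n ∸ ∣ T ∣) choose j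
  -- Here `T` has k + 1 elements, so no k-set contains it.
  pascal zero eq = cong (_+ 1) (count-⊇-small T (≤-reflexive (sym (trans (sym (+-identityʳ ∣ T ∣)) eq))))
  pascal (suc j) eq = trans
    (cong (_+ (n ∸ ∣ T ∣) choose suc j)
      (trans (cong (λ i → count (T ⊆?_) (subsets n i)) (sym (ℕ.suc-injective (trans (sym (+-suc ∣ T ∣ j)) eq)))) (count-⊇ T j)))
    (nCk+nC[k+1]≡[n+1]C[k+1] (n ∸ ∣ T ∣) j)

pairCount≡count-⊇ : ∀ {n} (e f : Fin n) F → pairCount e f F ≡ count ((⁅ e ⁆ ∪ ⁅ f ⁆) ⊆?_) F
pairCount≡count-⊇ e f F = count-≐ (both? e f) ((⁅ e ⁆ ∪ ⁅ f ⁆) ⊆?_) to from F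
  where
  to : ∀ {c} → e ∈ c × f ∈ c → ⁅ e ⁆ ∪ ⁅ f ⁆ ⊆ c
  to (e∈c , f∈c) i with x∈p∪q⁻ ⁅ e ⁆ ⁅ f ⁆ i
  ... | inj₁ j with refl ← x∈⁅y⁆⇒x≡y e j = e∈c
  ... | inj₂ j with refl ← x∈⁅y⁆⇒x≡y f j = f∈c
  from : ∀ {c} → ⁅ e ⁆ ∪ ⁅ f ⁆ ⊆ c → e ∈ c × f ∈ c
  from h = h (x∈p∪q⁺ (inj₁ (x∈⁅x⁆ e))) , h (x∈p∪q⁺ (inj₂ (x∈⁅x⁆ f)))

length-cartesianProduct : {A B : Set} (xs : List A) (ys : List B) → length (cartesianProduct xs ys) ≡ length xs * length ys
length-cartesianProduct []       ys = refl
length-cartesianProduct (x ∷ xs) ys = trans (length-++ (map (x ,_) ys)) (cong₂ _+_ (length-map (x ,_) ys) (length-cartesianProduct xs ys))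

concat-↭ : {A : Set} {xss yss : List (List A)} → xss ↭ yss → concat xss ↭ concat yss
concat-↭ _↭_.refl           = ↭-refl
concat-↭ (_↭_.prep xs σ)    = ++⁺ˡ xs (concat-↭ σ)
concat-↭ (_↭_.swap xs ys σ) = ↭-trans (++⁺ˡ xs (++⁺ˡ ys (concat-↭ σ))) (shifts xs ys)
concat-↭ (_↭_.trans σ τ)    = ↭-trans (concat-↭ σ) (concat-↭ τ)

-- Invariant families

record PermutationGroup (v : ℕ) : Set₁ where
  infixl 7 _·_
  infixr 8 _•_
  field
    Elt      : Set
    _·_      : Elt → Elt → Elt
    ε        : Elt
    _⁻¹      : Elt → Elt
    isGroup  : IsGroup _≡_ _·_ ε _⁻¹
    elements : List Elt
    complete : ∀ g → g ∈ˡ elements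
    unique   : Unique elements
    _•_      : Elt → Fin v → Fin v
    •-·      : ∀ g h x → (g · h) • x ≡ g • h • x
    •-ε      : ∀ x → ε • x ≡ x

  open IsGroup isGroup public using (assoc; identityˡ; identityʳ; inverseˡ; inverseʳ)

module Action {v : ℕ} (G : PermutationGroup v) where

  open PermutationGroup G

  •-⁻¹ : ∀ g x → g • (g ⁻¹ • x) ≡ x
  •-⁻¹ g x = trans (sym (•-· g (g ⁻¹) x)) (trans (cong (_• x) (inverseʳ g)) (•-ε x))

  ⁻¹-• : ∀ g x → g ⁻¹ • (g • x) ≡ x
  ⁻¹-• g x = trans (sym (•-· (g ⁻¹) g x)) (trans (cong (_• x) (inverseˡ g)) (•-ε x))

  ·-cancelʳ : ∀ g h → (g · h) · h ⁻¹ ≡ g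
  ·-cancelʳ g h = trans (assoc g h (h ⁻¹)) (trans (cong (g ·_) (inverseʳ h)) (identityʳ g))

  ·-cancelʳ′ : ∀ g h → (g · h ⁻¹) · h ≡ g
  ·-cancelʳ′ g h = trans (assoc g (h ⁻¹) h) (trans (cong (g ·_) (inverseˡ h)) (identityʳ g))

  ·-cancelˡ′ : ∀ g h → h · (h ⁻¹ · g) ≡ g
  ·-cancelˡ′ g h = trans (sym (assoc h (h ⁻¹) g)) (trans (cong (_· g) (inverseʳ h)) (identityˡ g))

  -- The group acts on subsets from the right, by preimages.
  act : Elt → Subset v → Subset v
  act g b = tabulate λ x → lookup b (g • x)

  ∈-act⁺ : ∀ {g b x} → g • x ∈ b → x ∈ act g b
  ∈-act⁺ {g} {b} {x} i = lookup⇒[]= x (act g b) (trans (lookup∘tabulate _ x) ([]=⇒lookup i))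

  ∈-act⁻ : ∀ {g b x} → x ∈ act g b → g • x ∈ b
  ∈-act⁻ {g} {b} {x} i = lookup⇒[]= (g • x) b (trans (sym (lookup∘tabulate _ x)) ([]=⇒lookup i))

  act-· : ∀ g h b → act (g · h) b ≡ act h (act g b)
  act-· g h b = tabulate-cong λ x → trans (cong (lookup b) (•-· g h x)) (sym (lookup∘tabulate _ (h • x)))

  act-ε : ∀ b → act ε b ≡ b
  act-ε b = trans (tabulate-cong λ x → cong (lookup b) (•-ε x)) (tabulate∘lookup b)

  act-⁻¹ : ∀ g b → act (g ⁻¹) (act g b) ≡ b
  act-⁻¹ g b = trans (sym (act-· g (g ⁻¹) b)) (trans (cong (λ h → act h b) (inverseʳ g)) (act-ε b))

  act-injective : ∀ g {b c} → act g b ≡ act g c → b ≡ c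
  act-injective g {b} {c} eq = trans (sym (act-⁻¹ g b)) (trans (cong (act (g ⁻¹)) eq) (act-⁻¹ g c))

  -- The indicator of `act g b` is that of `b` reindexed by the bijection `g •_`, and sums are
  -- invariant under reindexing.
  ∣act∣ : ∀ g b → ∣ act g b ∣ ≡ ∣ b ∣
  ∣act∣ g b = begin
    ∣ act g b ∣                 ≡⟨ ∣∣≡Σ (act g b) ⟩
    Σᶠ (indicator (act g b))    ≡⟨ sum-cong-≗ {v} {indicator (act g b)} {indicator b ∘ (g •_)} same ⟩
    Σᶠ (indicator b ∘ (g •_))   ≡⟨ sum-permute _ (permutation (g •_) (g ⁻¹ •_) (•-⁻¹ g) (⁻¹-• g)) ⟨
    Σᶠ (indicator b)            ≡⟨ ∣∣≡Σ b ⟨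
    ∣ b ∣                       ∎
    where
    open ≡-Reasoning
    same : ∀ x → indicator (act g b) x ≡ indicator b (g • x)
    same x = cong (if_then 1 else 0) (lookup∘tabulate _ x)

  Invariant : List (Subset v) → Set
  Invariant F = ∀ g {c} → c ∈ˡ F → act g c ∈ˡ F

  -- `act g` takes preimages, so it maps the blocks through g • e and g • f injectively to blocks
  -- through e and f.
  pairCount-•≤ : ∀ {F} → Unique F → Invariant F → ∀ g e f → pairCount (g • e) (g • f) F ≤ pairCount e f F
  pairCount-•≤ u inv g e f = count-injective (both? (g • e) (g • f)) (both? e f) (act g) (act-injective g) u
    λ { c∈F (i , j) → inv g c∈F , ∈-act⁺ i , ∈-act⁺ j }

  pairCount-• : ∀ {F} → Unique F → Invariant F → ∀ g e f → pairCount (g • e) (g • f) F ≡ pairCount e f F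
  pairCount-• {F} u inv g e f = ≤-antisym (pairCount-•≤ u inv g e f)
    (subst₂ (λ x y → pairCount x y F ≤ pairCount (g • e) (g • f) F) (⁻¹-• g e) (⁻¹-• g f)
      (pairCount-•≤ u inv (g ⁻¹) (g • e) (g • f)))

  orbit : Subset v → List (Subset v)
  orbit b = deduplicate _≟ˢ_ (map (λ g → act g b) elements)

  orbit-unique : ∀ b → Unique (orbit b)
  orbit-unique b = deduplicate-! _≟ˢ_ (map (λ g → act g b) elements)

  ∈-orbit⁺ : ∀ g b → act g b ∈ˡ orbit b
  ∈-orbit⁺ g b = ∈-deduplicate⁺ _≟ˢ_ (∈-map⁺ (λ g → act g b) (complete g))

  ∈-orbit⁻ : ∀ b {c} → c ∈ˡ orbit b → ∃ λ g → c ≡ act g b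
  ∈-orbit⁻ b i with ∈-map⁻ (λ g → act g b) (∈-deduplicate⁻ _≟ˢ_ (map (λ g → act g b) elements) i)
  ... | g , _ , eq = g , eq

  rep∈orbit : ∀ b → b ∈ˡ orbit b
  rep∈orbit b = subst (_∈ˡ orbit b) (act-ε b) (∈-orbit⁺ ε b)

  orbit-invariant : ∀ b → Invariant (orbit b)
  orbit-invariant b h i with ∈-orbit⁻ b i
  ... | g , refl = subst (_∈ˡ orbit b) (act-· g h b) (∈-orbit⁺ (g · h) b)

  orbit⊆ : ∀ {F b c} → Invariant F → b ∈ˡ F → c ∈ˡ orbit b → c ∈ˡ F
  orbit⊆ {b = b} inv b∈F i with ∈-orbit⁻ b i
  ... | g , refl = inv g b∈F

  orbit-sym : ∀ b {c} → c ∈ˡ orbit b → b ∈ˡ orbit c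
  orbit-sym b {c} i with ∈-orbit⁻ b i
  ... | g , refl = subst (_∈ˡ orbit c) (act-⁻¹ g b) (∈-orbit⁺ (g ⁻¹) c)

  orbit-↭ : ∀ b {c} → c ∈ˡ orbit b → orbit c ↭ orbit b
  orbit-↭ b {c} i = unique-↭ (orbit-unique c) (orbit-unique b)
    (orbit⊆ (orbit-invariant b) i) (orbit⊆ (orbit-invariant c) (orbit-sym b i))

  orbit-disjoint : ∀ b c → ¬ (orbit c ↭ orbit b) → ∀ {d} → ¬ (d ∈ˡ orbit b × d ∈ˡ orbit c)
  orbit-disjoint b c ¬p (i , j) = ¬p (↭-trans (↭-sym (orbit-↭ c j)) (orbit-↭ b i))

  -- Counting in an orbit by counting in the group

  stabiliser : Subset v → ℕ
  stabiliser b = count (λ g → act g b ≟ˢ b) elements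

  open Fibres {A = Elt} (_≟ˢ_ {v}) using (count-image≡)

  -- The elements that send `b` to `act g b` form the coset of the stabiliser by `g`; right
  -- multiplication by `g ⁻¹` and by `g` gives injections both ways.
  fibre≡stabiliser : ∀ b {c} → c ∈ˡ orbit b → count (λ g → act g b ≟ˢ c) elements ≡ stabiliser b
  fibre≡stabiliser b i with ∈-orbit⁻ b i
  ... | g , refl = ≤-antisym
    (count-injective _ _ (_· g ⁻¹) (λ {h} {k} eq → trans (sym (·-cancelʳ′ h g)) (trans (cong (_· g) eq) (·-cancelʳ′ k g))) unique
      λ { {h} _ eq → complete _ , trans (act-· h (g ⁻¹) b) (trans (cong (act (g ⁻¹)) eq) (act-⁻¹ g b)) })
    (count-injective _ _ (_· g) (λ {h} {k} eq → trans (sym (·-cancelʳ h g)) (trans (cong (_· g ⁻¹) eq) (·-cancelʳ k g))) unique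
      λ { {h} _ eq → complete _ , trans (act-· h g b) (cong (act g) eq) })

  -- Pair counts of an orbit become counts over the group, so the orbit never has to be computed.
  orbitStabiliser : ∀ e f b → pairCount e f (orbit b) * stabiliser b ≡ count (λ g → both? e f (act g b)) elements
  orbitStabiliser e f b = trans
    (sym (count-image≡ (λ g → act g b) elements (both? e f) (stabiliser b) (orbit b) (orbit-unique b) (fibre≡stabiliser b)))
    (count-≐ _ (λ g → both? e f (act g b)) proj₁ (λ {g} p → p , ∈-orbit⁺ g b) elements)

  stabiliser>0 : ∀ b → 0 < stabiliser b
  stabiliser>0 b = filter-some (λ g → act g b ≟ˢ b) (lose (complete ε) (act-ε b))

  pairStabiliser : Fin v → Fin v → ℕ
  pairStabiliser e f = count (λ g → ≡-dec _≟ᶠ_ _≟ᶠ_ (g • e , g • f) (e , f)) elements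

  -- If `act g b` contains e and f, then `g` sends (e , f) to one of the |b|² ordered pairs from
  -- `b`, and each pair is hit by at most `pairStabiliser e f` elements.
  orbit-pairCount≤ : ∀ e f b → pairCount e f (orbit b) ≤ ∣ b ∣ * ∣ b ∣ * pairStabiliser e f
  orbit-pairCount≤ e f b = begin
    pairCount e f (orbit b)                            ≤⟨ m≤m*n (pairCount e f (orbit b)) (stabiliser b) {{>-nonZero (stabiliser>0 b)}} ⟩
    pairCount e f (orbit b) * stabiliser b             ≡⟨ orbitStabiliser e f b ⟩
    count (λ g → both? e f (act g b)) elements         ≤⟨ count-⊆ (λ g → both? e f (act g b)) (λ g → (g • e , g • f) ∈²? pairs) inPairs elements ⟩
    count (λ g → (g • e , g • f) ∈²? pairs) elements   ≤⟨ count-image≤ (pairStabiliser e f) pairs fibre≤ ⟩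
    length pairs * pairStabiliser e f                  ≡⟨ cong (_* pairStabiliser e f) length-pairs ⟩
    ∣ b ∣ * ∣ b ∣ * pairStabiliser e f                 ∎
    where
    open ≤-Reasoning
    open Fibres (≡-dec (_≟ᶠ_ {v}) (_≟ᶠ_ {v})) (λ g → (g • e , g • f)) elements using (count-image≤; fibre)
    open DecMembership (≡-dec (_≟ᶠ_ {v}) (_≟ᶠ_ {v})) using () renaming (_∈?_ to _∈²?_)
    pairs : List (Fin v × Fin v)
    pairs = cartesianProduct (members b) (members b)
    length-pairs : length pairs ≡ ∣ b ∣ * ∣ b ∣
    length-pairs = trans (length-cartesianProduct (members b) (members b)) (cong₂ _*_ (length-members b) (length-members b))
    inPairs : ∀ {g} → e ∈ act g b × f ∈ act g b → (g • e , g • f) ∈ˡ pairs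
    inPairs (i , j) = ∈-cartesianProduct⁺ (∈-members⁺ {p = b} (∈-act⁻ i)) (∈-members⁺ {p = b} (∈-act⁻ j))
    fibre≤ : ∀ z → fibre z ≤ pairStabiliser e f
    fibre≤ z with filter (λ g → ≡-dec _≟ᶠ_ _≟ᶠ_ (g • e , g • f) z) elements in eq
    ... | [] = z≤n
    -- Left multiplication by `g ⁻¹`, for some `g` in the fibre, carries the fibre into the
    -- stabiliser of (e , f).
    ... | g ∷ _ with refl ← proj₂ (∈-filter⁻ (λ g → ≡-dec _≟ᶠ_ _≟ᶠ_ (g • e , g • f) z) {xs = elements} (subst (g ∈ˡ_) (sym eq) (here refl))) =
      subst (_≤ pairStabiliser e f) (cong length eq)
        (count-injective _ _ (g ⁻¹ ·_) (λ {h} {k} p → trans (sym (·-cancelˡ′ h g)) (trans (cong (g ·_) p) (·-cancelˡ′ k g))) unique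
          λ { {h} _ p → complete _ , cong₂ _,_ (back h e (cong proj₁ p)) (back h f (cong proj₂ p)) })
      where
      back : ∀ h x → h • x ≡ g • x → (g ⁻¹ · h) • x ≡ x
      back h x p = trans (•-· (g ⁻¹) h x) (trans (cong (g ⁻¹ •_) p) (⁻¹-• g x))

  -- The second hypothesis says that the stabiliser of `o` moves every other point to `p` or `q` up
  -- to inverses; conjugating by an element that takes `o` to `e` gives the same at `e`.
  rankThree : (o p q : Fin v) → (∀ e → ∃ λ g → g • o ≡ e) →
    (∀ f → o ≡ f ⊎ (∃ λ g → g • o ≡ o × (g • p ≡ f ⊎ g • q ≡ f))) →
    ∀ e f → e ≢ f → (∃ λ g → g • o ≡ e × g • p ≡ f) ⊎ (∃ λ g → g • o ≡ e × g • q ≡ f)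
  rankThree o p q point pair e f e≢f with point e
  ... | g , refl with pair (g ⁻¹ • f)
  ...   | inj₁ eq = contradiction (trans (cong (g •_) eq) (•-⁻¹ g f)) e≢f
  ...   | inj₂ (h , ho , inj₁ hp) = inj₁ (g · h , trans (•-· g h o) (cong (g •_) ho) , trans (•-· g h p) (trans (cong (g •_) hp) (•-⁻¹ g f)))
  ...   | inj₂ (h , ho , inj₂ hq) = inj₂ (g · h , trans (•-· g h o) (cong (g •_) ho) , trans (•-· g h q) (trans (cong (g •_) hq) (•-⁻¹ g f)))

  -- Designs as unions of orbits

  module RankThree (o p q : Fin v)
    (transitive : ∀ e f → e ≢ f → (∃ λ g → g • o ≡ e × g • p ≡ f) ⊎ (∃ λ g → g • o ≡ e × g • q ≡ f))
    (k : ℕ) where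

    -- `x` and `y` are fields with proofs, not functions of `rep`: for explicit orbits they are
    -- numerals, and arithmetic on them does not unfold the orbit.
    record Orbit : Set where
      field
        rep  : Subset v
        size : ∣ rep ∣ ≡ k
        x y  : ℕ
        x≡   : pairCount o p (orbit rep) ≡ x
        y≡   : pairCount o q (orbit rep) ≡ y

    open Orbit public

    fromRep : (b : Subset v) → ∣ b ∣ ≡ k → Orbit
    fromRep b eq = record { rep = b ; size = eq ; x≡ = refl ; y≡ = refl }

    blocks : List Orbit → List (Subset v)
    blocks Os = concat (map (orbit ∘ rep) Os)

    open Selection x y public using (X; Y; Balanced)

    blocks-++ : ∀ Os Ps → blocks (Os ++ Ps) ≡ blocks Os ++ blocks Ps
    blocks-++ []       Ps = refl
    blocks-++ (O ∷ Os) Ps = trans (cong (orbit (rep O) ++_) (blocks-++ Os Ps)) (sym (++-assoc (orbit (rep O)) (blocks Os) (blocks Ps)))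

    blocks-↭ : ∀ {Os Ps} → Os ↭ Ps → blocks Os ↭ blocks Ps
    blocks-↭ perm = concat-↭ (↭-map⁺ (orbit ∘ rep) perm)

    blocks-invariant : ∀ Os → Invariant (blocks Os)
    blocks-invariant (O ∷ Os) g i with ∈-++⁻ (orbit (rep O)) i
    ... | inj₁ j = ∈-++⁺ˡ (orbit-invariant (rep O) g j)
    ... | inj₂ j = ∈-++⁺ʳ (orbit (rep O)) (blocks-invariant Os g j)

    orbit-size : ∀ {b} → ∣ b ∣ ≡ k → All (λ c → ∣ c ∣ ≡ k) (orbit b)
    orbit-size {b} eq = All.tabulate λ i → let g , c≡ = ∈-orbit⁻ b i in trans (cong ∣_∣ c≡) (trans (∣act∣ g b) eq)

    blocks-size : ∀ Os → All (λ c → ∣ c ∣ ≡ k) (blocks Os)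
    blocks-size []       = []
    blocks-size (O ∷ Os) = All.++⁺ (orbit-size {rep O} (size O)) (blocks-size Os)

    pairCount-X : ∀ Os → pairCount o p (blocks Os) ≡ X Os
    pairCount-X []       = refl
    pairCount-X (O ∷ Os) = trans (count-++ (both? o p) (orbit (rep O)) (blocks Os)) (cong₂ _+_ (x≡ O) (pairCount-X Os))

    pairCount-Y : ∀ Os → pairCount o q (blocks Os) ≡ Y Os
    pairCount-Y []       = refl
    pairCount-Y (O ∷ Os) = trans (count-++ (both? o q) (orbit (rep O)) (blocks Os)) (cong₂ _+_ (y≡ O) (pairCount-Y Os))

    -- Pair counts of an invariant family are constant on group orbits of pairs, and every pair of
    -- distinct points is an image of (o , p) or (o , q).
    balancedDesign : ∀ {lam} Os → Unique (blocks Os) → Balanced lam Os → SimpleDesign 2 v k lam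
    balancedDesign {lam} Os u (Xeq , Yeq) = simpleDesign (blocks Os) u (blocks-size Os) regular
      where
      inv = blocks-invariant Os
      regular : ∀ e f → e ≢ f → pairCount e f (blocks Os) ≡ lam
      regular e f e≢f with transitive e f e≢f
      ... | inj₁ (g , refl , refl) = trans (pairCount-• u inv g o p) (trans (pairCount-X Os) Xeq)
      ... | inj₂ (g , refl , refl) = trans (pairCount-• u inv g o q) (trans (pairCount-Y Os) Yeq)

    open DecMembership (_≟ˢ_ {v}) using () renaming (_∈?_ to _∈ˡ?_)

    avoids? : (ds : List (Subset v)) → Decidable (_∉ˡ ds)
    avoids? ds c = ¬? (c ∈ˡ? ds)

    remove : List (Subset v) → List (Subset v) → List (Subset v)
    remove ds = filter (avoids? ds)

    remove-↭ : ∀ {ds F} → Unique ds → Unique F → (∀ {c} → c ∈ˡ ds → c ∈ˡ F) → F ↭ ds ++ remove ds F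
    remove-↭ {ds} {F} uds uF sub = unique-↭ uF
      (Unique.++⁺ uds (Unique.filter⁺ (avoids? ds) uF) λ (i , j) → proj₂ (∈-filter⁻ (avoids? ds) {xs = F} j) i) to
      λ i → [ sub , proj₁ ∘ ∈-filter⁻ (avoids? ds) {xs = F} ]′ (∈-++⁻ ds i)
      where
      to : ∀ {c} → c ∈ˡ F → c ∈ˡ ds ++ remove ds F
      to {c} i with c ∈ˡ? ds
      ... | yes j = ∈-++⁺ˡ j
      ... | no ¬j = ∈-++⁺ʳ ds (∈-filter⁺ (avoids? ds) i ¬j)

    remove-invariant : ∀ {ds F} → Invariant ds → Invariant F → Invariant (remove ds F)
    remove-invariant {ds} {F} inv inv′ g {c} i with ∈-filter⁻ (avoids? ds) {xs = F} i
    ... | c∈F , c∉ds = ∈-filter⁺ (avoids? ds) (inv′ g c∈F) λ j → c∉ds (subst (_∈ˡ ds) (act-⁻¹ g c) (inv (g ⁻¹) j))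

    -- Peels off the orbit of the first block; what remains is again invariant and shorter, so the
    -- length bound `n` decreases.
    partition : ∀ n F → length F ≤ n → Unique F → Invariant F → All (λ c → ∣ c ∣ ≡ k) F → ∃ λ Os → F ↭ blocks Os
    partition n       []      _        _ _   _             = [] , ↭-refl
    partition (suc n) F@(b ∷ F′) (s≤s le) u inv sz@(eq ∷ sz′) = fromRep b eq ∷ Os , ↭-trans peel (++⁺ˡ (orbit b) rest)
      where
      peel : F ↭ orbit b ++ remove (orbit b) F
      peel = remove-↭ (orbit-unique b) u (orbit⊆ inv (here refl))
      shorter : length (remove (orbit b) F) ≤ n
      shorter = ≤-trans (s≤s⁻¹ (filter-notAll (avoids? (orbit b)) F (here λ ¬i → ¬i (rep∈orbit b)))) le
      ih = partition n (remove (orbit b) F) shorter (Unique.filter⁺ (avoids? (orbit b)) u)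
        (remove-invariant (orbit-invariant b) inv) (All.filter⁺ (avoids? (orbit b)) sz)
      Os = proj₁ ih
      rest = proj₂ ih

    subsets-invariant : Invariant (subsets v k)
    subsets-invariant g {c} i = ∈-subsets⁺ (act g c) (trans (∣act∣ g c) (∈-subsets⁻ i))

    -- Orbits that meet coincide, and then so do their pair counts.
    distinct⇒disjoint : ∀ {O P} → (x O , y O) ≢ (x P , y P) → ∀ {d} → ¬ (d ∈ˡ orbit (rep O) × d ∈ˡ orbit (rep P))
    distinct⇒disjoint {O} {P} neq = orbit-disjoint (rep O) (rep P) λ perm → neq (cong₂ _,_
      (trans (sym (x≡ O)) (trans (sym (count-↭ (both? o p) perm)) (x≡ P)))
      (trans (sym (y≡ O)) (trans (sym (count-↭ (both? o q) perm)) (y≡ P))))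

    blocks-unique : ∀ Os → Unique (map (λ O → x O , y O) Os) → Unique (blocks Os)
    blocks-unique []       _        = []
    blocks-unique (O ∷ Os) (h ∷ u) = Unique.++⁺ (orbit-unique (rep O)) (blocks-unique Os u) (disjoint Os (All.map⁻ h))
      where
      disjoint : ∀ Ps → All (λ P → (x O , y O) ≢ (x P , y P)) Ps → ∀ {d} → ¬ (d ∈ˡ orbit (rep O) × d ∈ˡ blocks Ps)
      disjoint (P ∷ Ps) (neq ∷ neqs) (i , j) with ∈-++⁻ (orbit (rep P)) j
      ... | inj₁ j′ = distinct⇒disjoint {O} {P} neq (i , j′)
      ... | inj₂ j′ = disjoint Ps neqs (i , j′)

    complement : ∀ Os → Unique (blocks Os) → ∃ λ Ps → subsets v k ↭ blocks (Os ++ Ps)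
    complement Os u = Ps , ↭-trans (remove-↭ u U! sub) (↭-trans (++⁺ˡ (blocks Os) perm) (↭-reflexive (sym (blocks-++ Os Ps))))
      where
      U! = subsets-unique v k
      sub : ∀ {c} → c ∈ˡ blocks Os → c ∈ˡ subsets v k
      sub i = ∈-subsets⁺ _ (All.lookup (blocks-size Os) i)
      part = partition _ (remove (blocks Os) (subsets v k)) ≤-refl (Unique.filter⁺ (avoids? (blocks Os)) U!)
        (remove-invariant (blocks-invariant Os) subsets-invariant)
        (All.tabulate λ i → ∈-subsets⁻ (proj₁ (∈-filter⁻ (avoids? (blocks Os)) {xs = subsets v k} i)))
      Ps = proj₁ part
      perm = proj₂ part

    -- Both sums are read off from the family of all k-sets, without knowing x or y for any single
    -- added orbit.
    extend : ∀ Os → Unique (blocks Os) → ∀ j → k ≡ 2 + j → ∣ ⁅ o ⁆ ∪ ⁅ p ⁆ ∣ ≡ 2 → ∣ ⁅ o ⁆ ∪ ⁅ q ⁆ ∣ ≡ 2 →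
      ∃ λ Ps → Unique (blocks (Os ++ Ps)) × Balanced ((v ∸ 2) choose j) (Os ++ Ps)
    extend Os u j refl op oq with complement Os u
    ... | Ps , perm = Ps , unique-resp-↭ perm (subsets-unique v k)
      , trans (sym (pairCount-X (Os ++ Ps))) (trans (sym (count-↭ (both? o p) perm)) (total p op))
      , trans (sym (pairCount-Y (Os ++ Ps))) (trans (sym (count-↭ (both? o q) perm)) (total q oq))
      where
      total : ∀ f → ∣ ⁅ o ⁆ ∪ ⁅ f ⁆ ∣ ≡ 2 → pairCount o f (subsets v (2 + j)) ≡ (v ∸ 2) choose j
      total f eq = trans (pairCount≡count-⊇ o f (subsets v (2 + j)))
        (subst (λ t → count ((⁅ o ⁆ ∪ ⁅ f ⁆) ⊆?_) (subsets v (t + j)) ≡ (v ∸ t) choose j) eq (count-⊇ (⁅ o ⁆ ∪ ⁅ f ⁆) j))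

    selectionDesign : ∀ {lam} Os → Unique (blocks Os) → Split Os (Balanced lam) → SimpleDesign 2 v k lam
    selectionDesign Os u (split c r perm good) = balancedDesign c
      (unique-++⁻ˡ (blocks c) (subst Unique (blocks-++ c r) (unique-resp-↭ (blocks-↭ perm) u))) good

-- Explicit designs

through avoiding : ∀ {n} → List (Subset (suc n)) → List (Subset n)
through []                  = []
through ((inside ∷ p) ∷ B)  = p ∷ through B
through ((outside ∷ p) ∷ B) = through B
avoiding []                  = []
avoiding ((inside ∷ p) ∷ B)  = avoiding B
avoiding ((outside ∷ p) ∷ B) = p ∷ avoiding B

tails : ∀ {n} → List (Subset (suc n)) → List (Subset n)
tails = map Vec.tail

-- Each pair is examined at its smaller point: the blocks through that point are selected once and
-- must cover every later point `lam` times. A pair thus costs a scan of those blocks only.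
PointRegular PairRegular : ℕ → ∀ {n} → List (Subset n) → Set
PointRegular r {zero}  B = 0 ≡ 0
PointRegular r {suc n} B = length (through B) ≡ r × PointRegular r (tails B)
PairRegular lam {zero}  B = 0 ≡ 0
PairRegular lam {suc n} B = PointRegular lam (through B) × PairRegular lam (tails B)

pointRegular? : ∀ r {n} (B : List (Subset n)) → Dec (PointRegular r B)
pointRegular? r {zero}  B = 0 ≟ 0
pointRegular? r {suc n} B = (length (through B) ≟ r) ×-dec pointRegular? r (tails B)

pairRegular? : ∀ lam {n} (B : List (Subset n)) → Dec (PairRegular lam B)
pairRegular? lam {zero}  B = 0 ≟ 0
pairRegular? lam {suc n} B = pointRegular? lam (through B) ×-dec pairRegular? lam (tails B)

count-zero : ∀ {n} (B : List (Subset (suc n))) → count (zero ∈?_) B ≡ length (through B)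
count-zero []                  = refl
count-zero ((inside ∷ p) ∷ B)  = cong suc (count-zero B)
count-zero ((outside ∷ p) ∷ B) = count-zero B

count-suc : ∀ {n} (e : Fin n) B → count (suc e ∈?_) B ≡ count (e ∈?_) (tails B)
count-suc e [] = refl
count-suc e ((s ∷ p) ∷ B) with does (e ∈? p)
... | true  = cong suc (count-suc e B)
... | false = count-suc e B

pointRegular : ∀ r {n} (B : List (Subset n)) → PointRegular r B → ∀ e → count (e ∈?_) B ≡ r
pointRegular r B (eq , _) zero    = trans (count-zero B) eq
pointRegular r B (_ , h)  (suc e) = trans (count-suc e B) (pointRegular r (tails B) h e)

pairCount-comm : ∀ {n} (e f : Fin n) B → pairCount e f B ≡ pairCount f e B
pairCount-comm e f = count-≐ (both? e f) (both? f e) (λ (i , j) → j , i) (λ (i , j) → j , i)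

pairCount-zero : ∀ {n} (f : Fin n) B → pairCount zero (suc f) B ≡ count (f ∈?_) (through B)
pairCount-zero f [] = refl
pairCount-zero f ((inside ∷ p) ∷ B) with does (f ∈? p)
... | true  = cong suc (pairCount-zero f B)
... | false = pairCount-zero f B
pairCount-zero f ((outside ∷ p) ∷ B) = pairCount-zero f B

pairCount-suc : ∀ {n} (e f : Fin n) B → pairCount (suc e) (suc f) B ≡ pairCount e f (tails B)
pairCount-suc e f [] = refl
pairCount-suc e f ((s ∷ p) ∷ B) with does (e ∈? p) | does (f ∈? p)
... | true  | true  = cong suc (pairCount-suc e f B)
... | true  | false = pairCount-suc e f B
... | false | _     = pairCount-suc e f B

pairRegular : ∀ lam {n} (B : List (Subset n)) → PairRegular lam B → ∀ e f → e ≢ f → pairCount e f B ≡ lam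
pairRegular lam B _       zero    zero    e≢f = contradiction refl e≢f
pairRegular lam B (h , _) zero    (suc f) _   = trans (pairCount-zero f B) (pointRegular lam (through B) h f)
pairRegular lam B (h , _) (suc e) zero    _   = trans (pairCount-comm (suc e) zero B) (trans (pairCount-zero e B) (pointRegular lam (through B) h e))
pairRegular lam B (_ , h) (suc e) (suc f) e≢f = trans (pairCount-suc e f B) (pairRegular lam (tails B) h e f (e≢f ∘ cong suc))

-- Splits on one coordinate after another, as in a radix sort, instead of comparing all pairs. Two
-- entries that remain when no coordinates are left are equal.
distinct : ∀ {n} → List (Subset n) → Bool
distinct {n}     []      = true
distinct {n}     (b ∷ []) = true
distinct {zero}  (_ ∷ _ ∷ _) = false
distinct {suc n} B@(_ ∷ _ ∷ _) = distinct (through B) ∧ distinct (avoiding B)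

∈-through : ∀ {n} {p : Subset n} B → inside ∷ p ∈ˡ B → p ∈ˡ through B
∈-through ((inside ∷ _) ∷ B)  (here refl) = here refl
∈-through ((inside ∷ _) ∷ B)  (there i)   = there (∈-through B i)
∈-through ((outside ∷ _) ∷ B) (there i)   = ∈-through B i

∈-avoiding : ∀ {n} {p : Subset n} B → outside ∷ p ∈ˡ B → p ∈ˡ avoiding B
∈-avoiding ((outside ∷ _) ∷ B) (here refl) = here refl
∈-avoiding ((outside ∷ _) ∷ B) (there i)   = there (∈-avoiding B i)
∈-avoiding ((inside ∷ _) ∷ B)  (there i)   = ∈-avoiding B i

unique-heads : ∀ {n} (B : List (Subset (suc n))) → Unique (through B) → Unique (avoiding B) → Unique B
unique-heads [] _ _ = []
unique-heads ((inside ∷ p) ∷ B)  (p∉ ∷ u) w = All.tabulate (λ { i refl → All.lookup p∉ (∈-through B i) refl }) ∷ unique-heads B u w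
unique-heads ((outside ∷ p) ∷ B) u (p∉ ∷ w) = All.tabulate (λ { i refl → All.lookup p∉ (∈-avoiding B i) refl }) ∷ unique-heads B u w

distinct-sound : ∀ {n} (B : List (Subset n)) → distinct B ≡ true → Unique B
distinct-sound []       _ = []
distinct-sound (b ∷ []) _ = [] ∷ []
distinct-sound {suc n} B@(_ ∷ _ ∷ _) eq with distinct (through B) in eq₁ | distinct (avoiding B) in eq₂
... | true | true = unique-heads B (distinct-sound (through B) eq₁) (distinct-sound (avoiding B) eq₂)

-- Distinctness is left out so that designs add under concatenation; it is checked once for all
-- copies together.
record Design {v : ℕ} (k lam : ℕ) (B : List (Subset v)) : Set where
  constructor isDesign
  field
    sizes : All (λ b → ∣ b ∣ ≡ k) B
    pairs : ∀ e f → e ≢ f → pairCount e f B ≡ lam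

checkDesign : ∀ {v} → ℕ → ℕ → List (Subset v) → Bool
checkDesign k lam B = does (All.all? (λ b → ∣ b ∣ ≟ k) B) ∧ does (pairRegular? lam B)

checked : ∀ {v} k lam (B : List (Subset v)) → checkDesign k lam B ≡ true → Design k lam B
checked k lam B eq with All.all? (λ b → ∣ b ∣ ≟ k) B | pairRegular? lam B
... | yes s | yes h = isDesign s (pairRegular lam B h)

allChecked : ∀ {v} k lam (Bs : List (List (Subset v))) → all (checkDesign k lam) Bs ≡ true → All (Design k lam) Bs
allChecked k lam []       _ = []
allChecked k lam (B ∷ Bs) eq with checkDesign k lam B in eq′
... | true = checked k lam B eq′ ∷ allChecked k lam Bs eq

-- The point (m , k) of ℤ₁₁ × ℤ₅ is numbered 11 k + m.  As an edge of K₁₁ it is {m − 3ᵏ , m + 3ᵏ},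
-- and `affine j t` is then induced by z ↦ 3ʲ z + t.

block : ∀ n → ℕ → List ℕ → Subset n
block zero    i xs = []
block (suc n) i xs = any (i ≡ᵇ_) xs ∷ block n (suc i) xs

affine : ℕ → ℕ → ℕ → ℕ
affine j t i = 11 * ((i / 11 + j) % 5) + (3 ^ j * (i % 11) + t) % 11

-- Base blocks fixed by z ↦ 3 z are to be developed with js = [ 0 ].
develop : List ℕ → List (List ℕ) → List (List ℕ)
develop js bases = concatMap (λ b → concatMap (λ j → map (λ t → map (affine j t) b) (upTo 11)) js) bases

-- Since 2 is a unit of order 20 modulo 55, its powers give twenty relabellings of the points.
scale : ℕ → ℕ → ℕ
scale j i = (2 ^ j * i) % 55

opaque
  -- A 2-(55,10,λ) design has 33 λ blocks: 132 = 2 · 55 + 2 · 11, 165 = 3 · 55 and 363 = 6 · 55 + 3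
  -- · 11.
  blocks₄ blocks₅ blocks₁₁ : List (List ℕ)
  blocks₄ = develop (upTo 5)
      ((0 ∷ 1 ∷ 3 ∷ 6 ∷ 7 ∷ 12 ∷ 30 ∷ 33 ∷ 43 ∷ 50 ∷ []) ∷
       (0 ∷ 1 ∷ 8 ∷ 13 ∷ 15 ∷ 21 ∷ 23 ∷ 41 ∷ 52 ∷ 54 ∷ []) ∷ []) ++
    develop (0 ∷ [])
      ((4 ∷ 6 ∷ 12 ∷ 18 ∷ 25 ∷ 32 ∷ 41 ∷ 42 ∷ 46 ∷ 49 ∷ []) ∷
       (4 ∷ 8 ∷ 12 ∷ 13 ∷ 25 ∷ 28 ∷ 40 ∷ 42 ∷ 49 ∷ 54 ∷ []) ∷ [])
  blocks₅ = develop (upTo 5)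
      ((0 ∷ 1 ∷ 2 ∷ 4 ∷ 5 ∷ 7 ∷ 16 ∷ 27 ∷ 38 ∷ 49 ∷ []) ∷
       (0 ∷ 1 ∷ 15 ∷ 17 ∷ 27 ∷ 31 ∷ 40 ∷ 43 ∷ 47 ∷ 52 ∷ []) ∷
       (0 ∷ 1 ∷ 17 ∷ 19 ∷ 25 ∷ 29 ∷ 35 ∷ 38 ∷ 48 ∷ 53 ∷ []) ∷ [])
  blocks₁₁ = develop (upTo 5)
      ((0 ∷ 1 ∷ 3 ∷ 8 ∷ 11 ∷ 25 ∷ 28 ∷ 29 ∷ 47 ∷ 51 ∷ []) ∷
       (0 ∷ 1 ∷ 3 ∷ 18 ∷ 24 ∷ 38 ∷ 39 ∷ 40 ∷ 50 ∷ 52 ∷ []) ∷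
       (0 ∷ 1 ∷ 4 ∷ 5 ∷ 11 ∷ 21 ∷ 31 ∷ 37 ∷ 45 ∷ 49 ∷ []) ∷
       (0 ∷ 1 ∷ 4 ∷ 9 ∷ 18 ∷ 22 ∷ 29 ∷ 30 ∷ 47 ∷ 51 ∷ []) ∷
       (0 ∷ 1 ∷ 5 ∷ 6 ∷ 15 ∷ 17 ∷ 19 ∷ 22 ∷ 30 ∷ 42 ∷ []) ∷
       (0 ∷ 1 ∷ 9 ∷ 11 ∷ 23 ∷ 39 ∷ 40 ∷ 41 ∷ 46 ∷ 48 ∷ []) ∷ []) ++
    develop (0 ∷ [])
      ((6 ∷ 8 ∷ 13 ∷ 18 ∷ 28 ∷ 32 ∷ 40 ∷ 41 ∷ 46 ∷ 54 ∷ []) ∷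
       (7 ∷ 10 ∷ 19 ∷ 21 ∷ 24 ∷ 30 ∷ 35 ∷ 39 ∷ 50 ∷ 51 ∷ []) ∷
       (4 ∷ 7 ∷ 12 ∷ 21 ∷ 25 ∷ 30 ∷ 35 ∷ 42 ∷ 49 ∷ 50 ∷ []) ∷ [])

opaque
  unfolding blocks₄ blocks₅ blocks₁₁

  copies : List (List ℕ) → ℕ → List (List (Subset 55))
  copies D n = map (λ j → map (block 55 0 ∘ map (scale j)) D) (upTo n)

  copies₄ : All (Design 10 4) (copies blocks₄ 18)
  copies₄ = allChecked 10 4 (copies blocks₄ 18) refl

  copies₅ : All (Design 10 5) (copies blocks₅ 3)
  copies₅ = allChecked 10 5 (copies blocks₅ 3) refl

  copies-unique : Unique (concat (copies blocks₄ 18 ++ copies blocks₅ 3))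
  copies-unique = distinct-sound (concat (copies blocks₄ 18 ++ copies blocks₅ 3)) refl

  length-copies : ∀ D n → length (copies D n) ≡ n
  length-copies D n = trans (length-map _ (upTo n)) (length-upTo n)

  eleven : List (Subset 55)
  eleven = map (block 55 0) blocks₁₁

  eleven-design : Design 10 11 eleven
  eleven-design = checked 10 11 eleven refl

  eleven-unique : Unique eleven
  eleven-unique = distinct-sound eleven refl

split-take : {A : Set} (n : ℕ) (xs : List A) → Split xs (_≡ take n xs)
split-take zero    xs       = split-none xs
split-take (suc n) []       = split-none []
split-take (suc n) (x ∷ xs) with split-take n xs
... | split c r p refl = split (x ∷ c) r (↭-prep x p) refl

design-++ : ∀ {v k l m} {B C : List (Subset v)} → Design k l B → Design k m C → Design k (l + m) (B ++ C)
design-++ {B = B} {C} (isDesign s h) (isDesign s′ h′) =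
  isDesign (All.++⁺ s s′) λ e f e≢f → trans (count-++ (both? e f) B C) (cong₂ _+_ (h e f e≢f) (h′ e f e≢f))

design-take : ∀ {v k lam} {Bs : List (List (Subset v))} → All (Design k lam) Bs → ∀ n → n ≤ length Bs → Design k (n * lam) (concat (take n Bs))
design-take ds       zero    _        = isDesign [] λ _ _ _ → refl
design-take (d ∷ ds) (suc n) (s≤s le) = design-++ d (design-take ds n le)

-- As 5 ≡ 1 modulo 4, the least b in m = 4 a + 5 b is m modulo 4. The truncated subtraction spoils
-- the equation exactly when 5 b > m, the last time at m = 11; below 76 the largest a is 18, at m =
-- 72.
fours fives : ℕ → ℕ
fives m = m % 4
fours m = (m ∸ 5 * fives m) / 4

Representable : ℕ → Set
Representable m = fours m * 4 + fives m * 5 ≡ m × fours m ≤ 18 × fives m ≤ 3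

Exceptional : ℕ → Set
Exceptional m = (m ≤ 7 × m ≢ 4 × m ≢ 5) ⊎ m ≡ 11

representable : ∀ m → m < 76 → Representable m ⊎ Exceptional m
representable m m<76 = subst (λ m → Representable m ⊎ Exceptional m) (toℕ-fromℕ< m<76) (rows (fromℕ< m<76))
  where
  rows : ∀ (i : Fin 76) → Representable (toℕ i) ⊎ Exceptional (toℕ i)
  rows = witness (all? λ i → let m = toℕ i in
    ((fours m * 4 + fives m * 5 ≟ m) ×-dec (fours m ≤? 18) ×-dec (fives m ≤? 3)) ⊎-dec
    (((m ≤? 7) ×-dec ¬? (m ≟ 4) ×-dec ¬? (m ≟ 5)) ⊎-dec (m ≟ 11))) refl

sumDesign : ∀ a b → a ≤ 18 → b ≤ 3 → SimpleDesign 2 55 10 (a * 4 + b * 5)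
sumDesign a b a≤ b≤ = simpleDesign (concat chosen) unique (Design.sizes design) (Design.pairs design)
  where
  As Bs chosen : List (List (Subset 55))
  As = copies blocks₄ 18
  Bs = copies blocks₅ 3
  chosen = take a As ++ take b Bs
  sp : Split (As ++ Bs) (_≡ chosen)
  sp = split-++ (λ { refl refl → refl }) (split-take a As) (split-take b Bs)
  unique : Unique (concat chosen)
  unique with sp
  ... | split _ r perm refl = unique-++⁻ˡ (concat chosen)
    (subst Unique (sym (concat-++ chosen r)) (unique-resp-↭ (concat-↭ perm) copies-unique))
  design : Design 10 (a * 4 + b * 5) (concat chosen)
  design = subst (Design 10 (a * 4 + b * 5)) (concat-++ (take a As) (take b Bs))
    (design-++ (design-take copies₄ a (subst (a ≤_) (sym (length-copies blocks₄ 18)) a≤))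
                (design-take copies₅ b (subst (b ≤_) (sym (length-copies blocks₅ 3)) b≤)))

smallDesign : ∀ m → m < 76 → 7 < m ⊎ m ≡ 4 ⊎ m ≡ 5 → SimpleDesign 2 55 10 m
smallDesign m m<76 h = [ represented , exceptional h ]′ (representable m m<76)
  where
  represented : Representable m → SimpleDesign 2 55 10 m
  represented (eq , a≤ , b≤) = subst (SimpleDesign 2 55 10) eq (sumDesign (fours m) (fives m) a≤ b≤)
  exceptional : 7 < m ⊎ m ≡ 4 ⊎ m ≡ 5 → Exceptional m → SimpleDesign 2 55 10 m
  exceptional _                 (inj₂ m≡11)              = subst (SimpleDesign 2 55 10) (sym m≡11)
    (simpleDesign eleven eleven-unique (Design.sizes eleven-design) (Design.pairs eleven-design))
  exceptional (inj₁ 7<m)        (inj₁ (m≤7 , _))         = contradiction m≤7 (<⇒≱ 7<m)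
  exceptional (inj₂ (inj₁ m≡4)) (inj₁ (_ , m≢4 , _))     = contradiction m≡4 m≢4
  exceptional (inj₂ (inj₂ m≡5)) (inj₁ (_ , _ , m≢5))     = contradiction m≡5 m≢5

-- Permutations of eleven vertices

data V : Set where
  p0 p1 p2 p3 p4 p5 p6 p7 p8 p9 pX : V

vertices : List V
vertices = p0 ∷ p1 ∷ p2 ∷ p3 ∷ p4 ∷ p5 ∷ p6 ∷ p7 ∷ p8 ∷ p9 ∷ pX ∷ []

code : V → ℕ
code p0 = 0
code p1 = 1
code p2 = 2
code p3 = 3
code p4 = 4
code p5 = 5
code p6 = 6
code p7 = 7
code p8 = 8
code p9 = 9
code pX = 10

decode : ℕ → V
decode 0 = p0
decode 1 = p1
decode 2 = p2
decode 3 = p3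
decode 4 = p4
decode 5 = p5
decode 6 = p6
decode 7 = p7
decode 8 = p8
decode 9 = p9
decode _ = pX

decode∘code : ∀ v → decode (code v) ≡ v
decode∘code p0 = refl
decode∘code p1 = refl
decode∘code p2 = refl
decode∘code p3 = refl
decode∘code p4 = refl
decode∘code p5 = refl
decode∘code p6 = refl
decode∘code p7 = refl
decode∘code p8 = refl
decode∘code p9 = refl
decode∘code pX = refl

∈-vertices : ∀ v → v ∈ˡ vertices
∈-vertices p0 = here refl
∈-vertices p1 = there (here refl)
∈-vertices p2 = there (there (here refl))
∈-vertices p3 = there (there (there (here refl)))
∈-vertices p4 = there (there (there (there (here refl))))
∈-vertices p5 = there (there (there (there (there (here refl)))))
∈-vertices p6 = there (there (there (there (there (there (here refl))))))
∈-vertices p7 = there (there (there (there (there (there (there (here refl)))))))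
∈-vertices p8 = there (there (there (there (there (there (there (there (here refl))))))))
∈-vertices p9 = there (there (there (there (there (there (there (there (there (here refl)))))))))
∈-vertices pX = there (there (there (there (there (there (there (there (there (there (here refl))))))))))

_≟ⱽ_ : DecidableEquality V
u ≟ⱽ v = map′ (λ eq → trans (sym (decode∘code u)) (trans (cong decode eq) (decode∘code v))) (cong code) (code u ℕ.≟ code v)

-- Tables are records of their eleven entries, so that lookups are fast.
data Table (A : Set) : Set where
  table : (a₀ a₁ a₂ a₃ a₄ a₅ a₆ a₇ a₈ a₉ aₓ : A) → Table A

infixl 9 _!_

_!_ : {A : Set} → Table A → V → A
table a₀ _ _ _ _ _ _ _ _ _ _ ! p0 = a₀
table _ a₁ _ _ _ _ _ _ _ _ _ ! p1 = a₁
table _ _ a₂ _ _ _ _ _ _ _ _ ! p2 = a₂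
table _ _ _ a₃ _ _ _ _ _ _ _ ! p3 = a₃
table _ _ _ _ a₄ _ _ _ _ _ _ ! p4 = a₄
table _ _ _ _ _ a₅ _ _ _ _ _ ! p5 = a₅
table _ _ _ _ _ _ a₆ _ _ _ _ ! p6 = a₆
table _ _ _ _ _ _ _ a₇ _ _ _ ! p7 = a₇
table _ _ _ _ _ _ _ _ a₈ _ _ ! p8 = a₈
table _ _ _ _ _ _ _ _ _ a₉ _ ! p9 = a₉
table _ _ _ _ _ _ _ _ _ _ aₓ ! pX = aₓ

tabulate! : {A : Set} → (V → A) → Table A
tabulate! f = table (f p0) (f p1) (f p2) (f p3) (f p4) (f p5) (f p6) (f p7) (f p8) (f p9) (f pX)

!-tabulate! : {A : Set} (f : V → A) (v : V) → tabulate! f ! v ≡ f v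
!-tabulate! f p0 = refl
!-tabulate! f p1 = refl
!-tabulate! f p2 = refl
!-tabulate! f p3 = refl
!-tabulate! f p4 = refl
!-tabulate! f p5 = refl
!-tabulate! f p6 = refl
!-tabulate! f p7 = refl
!-tabulate! f p8 = refl
!-tabulate! f p9 = refl
!-tabulate! f pX = refl

tabulate!-! : {A : Set} (t : Table A) → tabulate! (t !_) ≡ t
tabulate!-! (table _ _ _ _ _ _ _ _ _ _ _) = refl

tabulate!-cong : {A : Set} {f g : V → A} → (∀ v → f v ≡ g v) → tabulate! f ≡ tabulate! g
tabulate!-cong {f = f} {g} h
  rewrite h p0 | h p1 | h p2 | h p3 | h p4 | h p5 | h p6 | h p7 | h p8 | h p9 | h pX = refl

!-ext : {A : Set} {s t : Table A} → (∀ v → s ! v ≡ t ! v) → s ≡ t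
!-ext {s = s} {t} h = trans (sym (tabulate!-! s)) (trans (tabulate!-cong h) (tabulate!-! t))

Perm : Set
Perm = Table V

infixl 7 _⊙_

ι : Perm
ι = tabulate! id

-- Opaque, because the symbolic unfolding of iterated products grows exponentially.
opaque
  _⊙_ : Perm → Perm → Perm
  p ⊙ q = tabulate! λ v → p ! (q ! v)

  ⊙-! : ∀ p q v → (p ⊙ q) ! v ≡ p ! (q ! v)
  ⊙-! p q = !-tabulate! _

⊙-assoc : ∀ p q r → (p ⊙ q) ⊙ r ≡ p ⊙ (q ⊙ r)
⊙-assoc p q r = !-ext λ v → begin
  ((p ⊙ q) ⊙ r) ! v   ≡⟨ ⊙-! (p ⊙ q) r v ⟩
  (p ⊙ q) ! (r ! v)   ≡⟨ ⊙-! p q (r ! v) ⟩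
  p ! (q ! (r ! v))   ≡⟨ cong (p !_) (⊙-! q r v) ⟨
  p ! ((q ⊙ r) ! v)   ≡⟨ ⊙-! p (q ⊙ r) v ⟨
  (p ⊙ (q ⊙ r)) ! v   ∎
  where open ≡-Reasoning

⊙-identityˡ : ∀ p → ι ⊙ p ≡ p
⊙-identityˡ p = !-ext λ v → trans (⊙-! ι p v) (!-tabulate! id (p ! v))

⊙-identityʳ : ∀ p → p ⊙ ι ≡ p
⊙-identityʳ p = !-ext λ v → trans (⊙-! p ι v) (cong (p !_) (!-tabulate! id v))

opaque
  _≟ᵖ_ : DecidableEquality Perm
  p ≟ᵖ q = map′ (λ h → !-ext λ v → All.lookup h (∈-vertices v)) (λ { refl → All.tabulate λ _ → refl })
    (All.all? (λ v → (p ! v) ≟ⱽ (q ! v)) vertices)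

-- Stabiliser chains

-- One level of a base with transversals, as in the Schreier-Sims method: `reps` represents the
-- cosets of the stabiliser of `base`, and group elements are products of one representative per
-- level.
record Level : Set where
  field
    base   : V
    degree : ℕ
    reps   : Vec Perm (suc degree)

  factor : Fin (suc degree) → Perm
  factor = lookup reps

open Level

Chain : Set
Chain = List Level

Index : Chain → Set
Index []      = ⊤
Index (l ∷ c) = Fin (suc (degree l)) × Index c

perm : ∀ c → Index c → Perm
perm []      _       = ι
perm (l ∷ c) (a , i) = factor l a ⊙ perm c i

indices : ∀ c → List (Index c)
indices []      = tt ∷ []
indices (l ∷ c) = cartesianProduct (allFin _) (indices c)

∈-indices : ∀ c i → i ∈ˡ indices c
∈-indices []      tt      = here refl
∈-indices (l ∷ c) (a , i) = ∈-cartesianProduct⁺ (∈-allFin a) (∈-indices c i)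

indices-unique : ∀ c → Unique (indices c)
indices-unique []      = [] ∷ []
indices-unique (l ∷ c) = Unique.cartesianProduct⁺ (Unique.allFin⁺ _) (indices-unique c)

-- Products are built from the left, so all elements with the same initial representatives share one
-- partial product.
tally : Chain → (Perm → Bool) → Perm → ℕ
tally []      f q = if f q then 1 else 0
tally (l ∷ c) f q = sum (map (λ a → tally c f (q ⊙ factor l a)) (allFin _))

count-cartesianProduct : {A B : Set} {P : A × B → Set} (P? : Decidable P) (xs : List A) (ys : List B) →
  count P? (cartesianProduct xs ys) ≡ sum (map (λ x → count (λ y → P? (x , y)) ys) xs)
count-cartesianProduct P? []       ys = refl
count-cartesianProduct P? (x ∷ xs) ys = trans (count-++ P? (map (x ,_) ys) (cartesianProduct xs ys))
  (cong₂ _+_ (count-map P? (x ,_) ys) (count-cartesianProduct P? xs ys))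

tally≡count : ∀ c (f : Perm → Bool) q → tally c f q ≡ count (λ i → T? (f (q ⊙ perm c i))) (indices c)
tally≡count [] f q rewrite ⊙-identityʳ q with f q
... | true  = refl
... | false = refl
tally≡count (l ∷ c) f q = trans (cong sum (map-cong level (allFin _)))
  (sym (count-cartesianProduct (λ i → T? (f (q ⊙ perm (l ∷ c) i))) (allFin _) (indices c)))
  where
  level : ∀ a → tally c f (q ⊙ factor l a) ≡ count (λ i → T? (f (q ⊙ (factor l a ⊙ perm c i)))) (indices c)
  level a = trans (tally≡count c f (q ⊙ factor l a))
    (count-≐ (λ i → T? (f ((q ⊙ factor l a) ⊙ perm c i))) (λ i → T? (f (q ⊙ (factor l a ⊙ perm c i))))
      (λ {i} → subst (T ∘ f) (⊙-assoc q (factor l a) (perm c i)))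
      (λ {i} → subst (T ∘ f) (sym (⊙-assoc q (factor l a) (perm c i)))) (indices c))

firstJust : {A B : Set} → (A → Maybe B) → List A → Maybe B
firstJust f []       = nothing
firstJust f (x ∷ xs) with f x
... | just y  = just y
... | nothing = firstJust f xs

firstJust-just : {A B : Set} (f : A → Maybe B) (xs : List A) {y : B} → firstJust f xs ≡ just y → ∃ λ x → f x ≡ just y
firstJust-just f (x ∷ xs) eq with f x in eq′
... | just y  = x , trans eq′ eq
... | nothing = firstJust-just f xs eq

-- Searches for `i` with q ⊙ perm c i ≡ p. The image of the base prunes the search at every level;
-- correctness comes from comparing the complete product at the end.
sift : ∀ c → Perm → Perm → Maybe (Index c)
siftAt : ∀ l c → Perm → Perm → Fin (suc (degree l)) → Maybe (Index (l ∷ c))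

sift []      q p = if does (q ≟ᵖ p) then just tt else nothing
sift (l ∷ c) q p = firstJust (siftAt l c q p) (allFin _)

siftAt l c q p a = if does ((q ! (factor l a ! base l)) ≟ⱽ (p ! base l))
  then Maybe.map (a ,_) (sift c (q ⊙ factor l a) p) else nothing

sift-sound : ∀ c q p {i} → sift c q p ≡ just i → q ⊙ perm c i ≡ p
sift-sound [] q p eq with q ≟ᵖ p
... | yes refl = ⊙-identityʳ q
... | no _ with () ← eq
sift-sound (l ∷ c) q p eq with firstJust-just (siftAt l c q p) (allFin _) eq
... | a , eq′ with does ((q ! (factor l a ! base l)) ≟ⱽ (p ! base l))
... | true with sift c (q ⊙ factor l a) p in eq″
...   | just i with refl ← eq′ = trans (sym (⊙-assoc q (factor l a) (perm c i))) (sift-sound c (q ⊙ factor l a) p eq″)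

_∈ᶜ_ : Perm → Chain → Set
p ∈ᶜ c = ∃ λ i → perm c i ≡ p

opaque
  Sifts : Chain → Perm → Set
  Sifts c p = T (is-just (sift c ι p))

  sifts? : ∀ c p → Dec (Sifts c p)
  sifts? c p = T? _

  sifts⇒∈ : ∀ c p → Sifts c p → p ∈ᶜ c
  sifts⇒∈ c p s with sift c ι p in eq
  ... | just i = i , trans (sym (⊙-identityˡ (perm c i))) (sift-sound c ι p eq)

opaque
  -- The default `p0` is reached only when a value is missed. That the result is an inverse is
  -- checked for each representative in `inverses`.
  invert : Perm → Perm
  invert p = tabulate! λ v → Maybe.fromMaybe p0 (firstJust (λ u → if does ((p ! u) ≟ⱽ v) then just u else nothing) vertices)

-- Multiplying two elements u h and u′ h′ of U H needs only that H U and U U lie in U H.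
regroup : ∀ u u′ h h′ {v k w l m n} → v ⊙ k ≡ h ⊙ u′ → w ⊙ l ≡ u ⊙ v → m ≡ k ⊙ h′ → n ≡ l ⊙ m →
  w ⊙ n ≡ (u ⊙ h) ⊙ (u′ ⊙ h′)
regroup u u′ h h′ {v} {k} {w} {l} {m} {n} eq eq′ eq″ eq‴ = begin
  w ⊙ n                  ≡⟨ cong (w ⊙_) eq‴ ⟩
  w ⊙ (l ⊙ m)            ≡⟨ ⊙-assoc w l m ⟨
  (w ⊙ l) ⊙ m            ≡⟨ cong₂ _⊙_ eq′ eq″ ⟩
  (u ⊙ v) ⊙ (k ⊙ h′)     ≡⟨ ⊙-assoc u v (k ⊙ h′) ⟩
  u ⊙ (v ⊙ (k ⊙ h′))     ≡⟨ cong (u ⊙_) (⊙-assoc v k h′) ⟨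
  u ⊙ ((v ⊙ k) ⊙ h′)     ≡⟨ cong (λ p → u ⊙ (p ⊙ h′)) eq ⟩
  u ⊙ ((h ⊙ u′) ⊙ h′)    ≡⟨ cong (u ⊙_) (⊙-assoc h u′ h′) ⟩
  u ⊙ (h ⊙ (u′ ⊙ h′))    ≡⟨ ⊙-assoc u h (u′ ⊙ h′) ⟨
  (u ⊙ h) ⊙ (u′ ⊙ h′)    ∎
  where open ≡-Reasoning

cancel : ∀ p {q r} s → q ⊙ r ≡ ι → (p ⊙ q) ⊙ (r ⊙ s) ≡ p ⊙ s
cancel p {q} {r} s qr = begin
  (p ⊙ q) ⊙ (r ⊙ s) ≡⟨ ⊙-assoc p q (r ⊙ s) ⟩
  p ⊙ (q ⊙ (r ⊙ s)) ≡⟨ cong (p ⊙_) (⊙-assoc q r s) ⟨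
  p ⊙ ((q ⊙ r) ⊙ s) ≡⟨ cong (λ z → p ⊙ (z ⊙ s)) qr ⟩
  p ⊙ (ι ⊙ s)       ≡⟨ cong (p ⊙_) (⊙-identityˡ s) ⟩
  p ⊙ s             ∎
  where open ≡-Reasoning

-- With U the representatives and H the elements of `c`, these finitely many checks make U H a group
-- once H is one: H U and U U lie in U H, and U has inverses there. `fixes` and `separates` make the
-- factorisation unique, because an element's value at the base determines its representative.
record ClosedLevel (l : Level) (c : Chain) : Set where
  field
    trivial   : factor l zero ≡ ι
    exchange  : All (λ m → All (λ b → All (λ a → Sifts (l ∷ c) (factor m b ⊙ factor l a)) (allFin _)) (allFin _)) c
    products  : All (λ a → All (λ b → Sifts (l ∷ c) (factor l a ⊙ factor l b)) (allFin _)) (allFin _)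
    inverses  : All (λ a → Sifts (l ∷ c) (invert (factor l a)) × invert (factor l a) ⊙ factor l a ≡ ι × factor l a ⊙ invert (factor l a) ≡ ι)
                  (allFin _)
    fixes     : All (λ m → All (λ b → factor m b ! base l ≡ base l) (allFin _)) c
    separates : All (λ a → All (λ b → factor l a ! base l ≡ factor l b ! base l → a ≡ b) (allFin _)) (allFin _)

closedLevel? : ∀ l c → Dec (ClosedLevel l c)
closedLevel? l c = map′
  (λ (t , e , p , i , f , s) → record { trivial = t ; exchange = e ; products = p ; inverses = i ; fixes = f ; separates = s })
  (λ C → let open ClosedLevel C in trivial , exchange , products , inverses , fixes , separates)
  ((factor l zero ≟ᵖ ι)
    ×-dec All.all? (λ m → All.all? (λ b → All.all? (λ a → sifts? (l ∷ c) (factor m b ⊙ factor l a)) (allFin _)) (allFin _)) c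
    ×-dec All.all? (λ a → All.all? (λ b → sifts? (l ∷ c) (factor l a ⊙ factor l b)) (allFin _)) (allFin _)
    ×-dec All.all? (λ a → sifts? (l ∷ c) (invert (factor l a))
      ×-dec ((invert (factor l a) ⊙ factor l a) ≟ᵖ ι) ×-dec ((factor l a ⊙ invert (factor l a)) ≟ᵖ ι)) (allFin _)
    ×-dec All.all? (λ m → All.all? (λ b → (factor m b ! base l) ≟ⱽ base l) (allFin _)) c
    ×-dec All.all? (λ a → All.all? (λ b → ((factor l a ! base l) ≟ⱽ (factor l b ! base l)) →-dec (a ≟ᶠ b)) (allFin _)) (allFin _))

data Closed : Chain → Set where
  []  : Closed []
  _∷_ : ∀ {l c} → ClosedLevel l c → Closed c → Closed (l ∷ c)

closed-ι : ∀ {c} → Closed c → ι ∈ᶜ c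
closed-ι []      = tt , refl
closed-ι {l ∷ c} (L ∷ C) = (zero , proj₁ (closed-ι C)) ,
  trans (cong₂ _⊙_ (ClosedLevel.trivial L) (proj₂ (closed-ι C))) (⊙-identityˡ ι)

module _ {l : Level} {c : Chain} (L : ClosedLevel l c) where
  open ClosedLevel L

  level-products : ∀ a b → (factor l a ⊙ factor l b) ∈ᶜ (l ∷ c)
  level-products a b = sifts⇒∈ (l ∷ c) _ (All.lookup (All.lookup products (∈-allFin a)) (∈-allFin b))

  level-inverses : ∀ a → Sifts (l ∷ c) (invert (factor l a)) × invert (factor l a) ⊙ factor l a ≡ ι × factor l a ⊙ invert (factor l a) ≡ ι
  level-inverses a = All.lookup inverses (∈-allFin a)

  -- The factors of the element of H are moved past the representative one at a time, the rightmost
  -- first; the elements of H left behind are multiplied together by `mult`.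
  level-exchange : ι ∈ᶜ c → (∀ i j → (perm c i ⊙ perm c j) ∈ᶜ c) → ∀ i a → (perm c i ⊙ factor l a) ∈ᶜ (l ∷ c)
  level-exchange (e , e≡ι) mult = go c exchange
    where
    go : ∀ d → All (λ m → All (λ b → All (λ a → Sifts (l ∷ c) (factor m b ⊙ factor l a)) (allFin _)) (allFin _)) d →
      ∀ i a → (perm d i ⊙ factor l a) ∈ᶜ (l ∷ c)
    go [] [] tt a = (a , e) , trans (cong (factor l a ⊙_) e≡ι) (trans (⊙-identityʳ (factor l a)) (sym (⊙-identityˡ (factor l a))))
    go (m ∷ d) (h ∷ hs) (b , i) a with go d hs i a
    ... | (a′ , k) , eq with sifts⇒∈ (l ∷ c) _ (All.lookup (All.lookup h (∈-allFin b)) (∈-allFin a′))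
    ... | (a″ , k′) , eq′ with mult k′ k
    ... | n , eq″ = (a″ , n) , (begin
      factor l a″ ⊙ perm c n                    ≡⟨ cong (factor l a″ ⊙_) eq″ ⟩
      factor l a″ ⊙ (perm c k′ ⊙ perm c k)      ≡⟨ ⊙-assoc (factor l a″) (perm c k′) (perm c k) ⟨
      (factor l a″ ⊙ perm c k′) ⊙ perm c k      ≡⟨ cong (_⊙ perm c k) eq′ ⟩
      (factor m b ⊙ factor l a′) ⊙ perm c k        ≡⟨ ⊙-assoc (factor m b) (factor l a′) (perm c k) ⟩
      factor m b ⊙ (factor l a′ ⊙ perm c k)        ≡⟨ cong (factor m b ⊙_) eq ⟩
      factor m b ⊙ (perm d i ⊙ factor l a)         ≡⟨ ⊙-assoc (factor m b) (perm d i) (factor l a) ⟨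
      (factor m b ⊙ perm d i) ⊙ factor l a         ∎)
      where open ≡-Reasoning

  level-fixes : ∀ i → perm c i ! base l ≡ base l
  level-fixes = go c fixes
    where
    go : ∀ d → All (λ m → All (λ b → factor m b ! base l ≡ base l) (allFin _)) d → ∀ i → perm d i ! base l ≡ base l
    go []      []       tt      = !-tabulate! id (base l)
    go (m ∷ d) (h ∷ hs) (b , i) = trans (⊙-! (factor m b) (perm d i) (base l))
      (trans (cong (factor m b !_) (go d hs i)) (All.lookup h (∈-allFin b)))

  level-separates : ∀ {a b i j} → perm (l ∷ c) (a , i) ≡ perm (l ∷ c) (b , j) → a ≡ b
  level-separates {a} {b} {i} {j} eq = All.lookup (All.lookup separates (∈-allFin a)) (∈-allFin b)
    (trans (sym (image a i)) (trans (cong (_! base l) eq) (image b j)))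
    where
    image : ∀ a i → perm (l ∷ c) (a , i) ! base l ≡ factor l a ! base l
    image a i = trans (⊙-! (factor l a) (perm c i) (base l)) (cong (factor l a !_) (level-fixes i))

  level-cancel : ∀ {a i j} → perm (l ∷ c) (a , i) ≡ perm (l ∷ c) (a , j) → perm c i ≡ perm c j
  level-cancel {a} {i} {j} eq = trans (sym (strip i)) (trans (cong (invert (factor l a) ⊙_) eq) (strip j))
    where
    strip : ∀ i → invert (factor l a) ⊙ (factor l a ⊙ perm c i) ≡ perm c i
    strip i = trans (sym (⊙-assoc (invert (factor l a)) (factor l a) (perm c i)))
      (trans (cong (_⊙ perm c i) (proj₁ (proj₂ (level-inverses a)))) (⊙-identityˡ (perm c i)))

closed-⊙ : ∀ {c} → Closed c → ∀ i j → (perm c i ⊙ perm c j) ∈ᶜ c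
closed-⊙ []      tt      tt      = tt , sym (⊙-identityʳ ι)
closed-⊙ {l ∷ c} (L ∷ C) (a , i) (b , j) with level-exchange L (closed-ι C) (closed-⊙ C) i b
... | (b′ , i′) , eq with level-products L a b′
... | (d , k) , eq′ with closed-⊙ C i′ j
... | m , eq″ with closed-⊙ C k m
... | n , eq‴ = (d , n) , regroup (factor l a) (factor l b) (perm c i) (perm c j) eq eq′ eq″ eq‴

Inverses : Chain → Perm → Set
Inverses c p = ∃ λ j → perm c j ⊙ p ≡ ι × p ⊙ perm c j ≡ ι

closed-⁻¹ : ∀ {c} → Closed c → ∀ i → Inverses c (perm c i)
closed-⁻¹ [] tt = tt , ⊙-identityʳ ι , ⊙-identityʳ ι
closed-⁻¹ {l ∷ c} (L ∷ C) (a , i) = m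
  , trans (cong (_⊙ (factor l a ⊙ perm c i)) m≡) (trans (cancel (perm c j) (perm c i) (proj₁ (proj₂ lev))) (proj₁ (proj₂ ih)))
  , trans (cong ((factor l a ⊙ perm c i) ⊙_) m≡) (trans (cancel (factor l a) (invert (factor l a)) (proj₂ (proj₂ ih))) (proj₂ (proj₂ lev)))
  where
  ih : Inverses c (perm c i)
  ih = closed-⁻¹ C i
  j : Index c
  j = proj₁ ih
  lev : Sifts (l ∷ c) (invert (factor l a)) × invert (factor l a) ⊙ factor l a ≡ ι × factor l a ⊙ invert (factor l a) ≡ ι
  lev = level-inverses L a
  u⁻ : invert (factor l a) ∈ᶜ (l ∷ c)
  u⁻ = sifts⇒∈ (l ∷ c) (invert (factor l a)) (proj₁ lev)
  prod : (perm (l ∷ c) (zero , j) ⊙ perm (l ∷ c) (proj₁ u⁻)) ∈ᶜ (l ∷ c)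
  prod = closed-⊙ (L ∷ C) (zero , j) (proj₁ u⁻)
  m : Index (l ∷ c)
  m = proj₁ prod
  zero-j : perm (l ∷ c) (zero , j) ≡ perm c j
  zero-j = trans (cong (_⊙ perm c j) (ClosedLevel.trivial L)) (⊙-identityˡ (perm c j))
  m≡ : perm (l ∷ c) m ≡ perm c j ⊙ invert (factor l a)
  m≡ = trans (proj₂ prod) (cong₂ _⊙_ zero-j (proj₂ u⁻))

-- Indices can now stand for permutations: group laws up to `≡` on indices may be proved on
-- permutations, and `indices` lists every element once.
perm-injective : ∀ {c} → Closed c → ∀ {i j} → perm c i ≡ perm c j → i ≡ j
perm-injective []      _  = refl
perm-injective (L ∷ C) {a , i} {b , j} eq with refl ← level-separates L {a} {b} {i} {j} eq =
  cong (a ,_) (perm-injective C (level-cancel L {a} {i} {j} eq))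

-- The Mathieu group M₁₁

-- The powers of an 11-cycle. The four levels have 11 · 10 · 9 · 8 = 7920 products, the order of
-- M₁₁, which is sharply 4-transitive.
level0 : Level
level0 = record { base = p0 ; degree = 10 ; reps =
  table p0 p1 p2 p3 p4 p5 p6 p7 p8 p9 pX ∷
  table p1 p2 p3 p4 p5 p6 p7 p8 p9 pX p0 ∷
  table p2 p3 p4 p5 p6 p7 p8 p9 pX p0 p1 ∷
  table p3 p4 p5 p6 p7 p8 p9 pX p0 p1 p2 ∷
  table p4 p5 p6 p7 p8 p9 pX p0 p1 p2 p3 ∷
  table p5 p6 p7 p8 p9 pX p0 p1 p2 p3 p4 ∷
  table p6 p7 p8 p9 pX p0 p1 p2 p3 p4 p5 ∷
  table p7 p8 p9 pX p0 p1 p2 p3 p4 p5 p6 ∷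
  table p8 p9 pX p0 p1 p2 p3 p4 p5 p6 p7 ∷
  table p9 pX p0 p1 p2 p3 p4 p5 p6 p7 p8 ∷
  table pX p0 p1 p2 p3 p4 p5 p6 p7 p8 p9 ∷
  [] }

level1 : Level
level1 = record { base = p1 ; degree = 9 ; reps =
  table p0 p1 p2 p3 p4 p5 p6 p7 p8 p9 pX ∷
  table p0 p2 p1 p3 pX p6 p5 p8 p7 p9 p4 ∷
  table p0 p3 p1 p2 p7 p4 p8 p5 pX p9 p6 ∷
  table p0 p4 p1 p2 p3 p9 p6 p8 p5 p7 pX ∷
  table p0 p5 p1 p2 p8 pX p4 p9 p7 p6 p3 ∷
  table p0 p6 p1 p2 pX p8 p7 p3 p4 p5 p9 ∷
  table p0 p7 p1 p2 p9 p3 p5 pX p6 p4 p8 ∷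
  table p0 p8 p1 p2 p6 p5 p9 p7 p3 pX p4 ∷
  table p0 p9 p1 p2 p4 p7 pX p6 p8 p3 p5 ∷
  table p0 pX p1 p2 p5 p6 p3 p4 p9 p8 p7 ∷
  [] }

level2 : Level
level2 = record { base = p2 ; degree = 8 ; reps =
  table p0 p1 p2 p3 p4 p5 p6 p7 p8 p9 pX ∷
  table p0 p1 p3 p2 p6 p8 p4 pX p5 p9 p7 ∷
  table p0 p1 p4 p2 pX p6 p9 p5 p8 p7 p3 ∷
  table p0 p1 p5 p2 p3 p4 pX p7 p9 p6 p8 ∷
  table p0 p1 p6 p2 p9 p7 p8 p4 p3 p5 pX ∷
  table p0 p1 p7 p2 p8 p5 p3 p6 pX p4 p9 ∷
  table p0 p1 p8 p2 p4 p9 p5 p3 p7 pX p6 ∷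
  table p0 p1 p9 p2 p5 pX p7 p8 p6 p3 p4 ∷
  table p0 p1 pX p2 p7 p3 p6 p9 p4 p8 p5 ∷
  [] }

level3 : Level
level3 = record { base = p3 ; degree = 7 ; reps =
  table p0 p1 p2 p3 p4 p5 p6 p7 p8 p9 pX ∷
  table p0 p1 p2 p4 p9 p8 pX p3 p6 p7 p5 ∷
  table p0 p1 p2 p5 pX p9 p3 p8 p4 p6 p7 ∷
  table p0 p1 p2 p6 p8 p3 p9 pX p7 p5 p4 ∷
  table p0 p1 p2 p7 p3 pX p8 p9 p5 p4 p6 ∷
  table p0 p1 p2 p8 p5 p7 p4 p6 p9 pX p3 ∷
  table p0 p1 p2 p9 p7 p6 p5 p4 pX p3 p8 ∷
  table p0 p1 p2 pX p6 p4 p7 p5 p3 p8 p9 ∷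
  [] }

opaque
  M₁₁ : Chain
  M₁₁ = level0 ∷ level1 ∷ level2 ∷ level3 ∷ []

opaque
  unfolding M₁₁ _⊙_ invert Sifts _≟ᵖ_

  M₁₁-closed : Closed M₁₁
  M₁₁-closed = witness (closedLevel? level0 (level1 ∷ level2 ∷ level3 ∷ [])) refl
    ∷ witness (closedLevel? level1 (level2 ∷ level3 ∷ [])) refl
    ∷ witness (closedLevel? level2 (level3 ∷ [])) refl
    ∷ witness (closedLevel? level3 []) refl ∷ []

-- The action on the 55 edges of the complete graph

ends : Vec (V × V) 55
ends =
  (p0 , p1) ∷
  (p0 , p2) ∷ (p1 , p2) ∷
  (p0 , p3) ∷ (p1 , p3) ∷ (p2 , p3) ∷
  (p0 , p4) ∷ (p1 , p4) ∷ (p2 , p4) ∷ (p3 , p4) ∷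
  (p0 , p5) ∷ (p1 , p5) ∷ (p2 , p5) ∷ (p3 , p5) ∷ (p4 , p5) ∷
  (p0 , p6) ∷ (p1 , p6) ∷ (p2 , p6) ∷ (p3 , p6) ∷ (p4 , p6) ∷ (p5 , p6) ∷
  (p0 , p7) ∷ (p1 , p7) ∷ (p2 , p7) ∷ (p3 , p7) ∷ (p4 , p7) ∷ (p5 , p7) ∷ (p6 , p7) ∷
  (p0 , p8) ∷ (p1 , p8) ∷ (p2 , p8) ∷ (p3 , p8) ∷ (p4 , p8) ∷ (p5 , p8) ∷ (p6 , p8) ∷ (p7 , p8) ∷
  (p0 , p9) ∷ (p1 , p9) ∷ (p2 , p9) ∷ (p3 , p9) ∷ (p4 , p9) ∷ (p5 , p9) ∷ (p6 , p9) ∷ (p7 , p9) ∷ (p8 , p9) ∷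
  (p0 , pX) ∷ (p1 , pX) ∷ (p2 , pX) ∷ (p3 , pX) ∷ (p4 , pX) ∷ (p5 , pX) ∷ (p6 , pX) ∷ (p7 , pX) ∷ (p8 , pX) ∷ (p9 , pX) ∷
  []

locate : ∀ {n} → Vec (V × V) (suc n) → V → V → Fin (suc n)
locate (_ ∷ [])                u v = zero
locate ((a , b) ∷ es@(_ ∷ _)) u v =
  if (does (a ≟ⱽ u) ∧ does (b ≟ⱽ v)) ∨ (does (a ≟ⱽ v) ∧ does (b ≟ⱽ u)) then zero else suc (locate es u v)

-- The value at u = v is junk.
opaque
  edge : V → V → Fin 55
  edge = locate ends

tail head : Fin 55 → V
tail e = proj₁ (lookup ends e)
head e = proj₂ (lookup ends e)

∀ⱽ : {P : V → Set} → All P vertices → ∀ v → P v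
∀ⱽ h v = All.lookup h (∈-vertices v)

opaque
  unfolding edge

  edge-ends : ∀ e → edge (tail e) (head e) ≡ e
  edge-ends = witness (all? λ e → edge (tail e) (head e) ≟ᶠ e) refl

  tail≢head : ∀ e → tail e ≢ head e
  tail≢head = witness (all? λ e → ¬? (tail e ≟ⱽ head e)) refl

  edge-sym : ∀ u v → edge u v ≡ edge v u
  edge-sym u = ∀ⱽ (∀ⱽ (witness (All.all? (λ u → All.all? (λ v → edge u v ≟ᶠ edge v u) vertices) vertices) refl) u)

  ends-edge : ∀ u v → u ≡ v ⊎ lookup ends (edge u v) ≡ (u , v) ⊎ lookup ends (edge u v) ≡ (v , u)
  ends-edge u = ∀ⱽ (∀ⱽ (witness (All.all? (λ u → All.all? (λ v → (u ≟ⱽ v) ⊎-dec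
    (≡-dec _≟ⱽ_ _≟ⱽ_ (lookup ends (edge u v)) (u , v) ⊎-dec ≡-dec _≟ⱽ_ _≟ⱽ_ (lookup ends (edge u v)) (v , u))) vertices) vertices) refl) u)

-- `edge` forgets the order of its endpoints, so only symmetric functions can be read back from
-- them.
edge-elim : {A : Set} (f : V → V → A) → (∀ u v → f u v ≡ f v u) → ∀ {u v} → u ≢ v → f (tail (edge u v)) (head (edge u v)) ≡ f u v
edge-elim f f-sym {u} {v} u≢v with ends-edge u v
... | inj₁ u≡v              = contradiction u≡v u≢v
... | inj₂ (inj₁ eq) rewrite eq = refl
... | inj₂ (inj₂ eq) rewrite eq = f-sym v u

M₁₁-Elt : Set
M₁₁-Elt = Index M₁₁

_•ᴱ_ : M₁₁-Elt → Fin 55 → Fin 55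
g •ᴱ e = edge (perm M₁₁ g ! tail e) (perm M₁₁ g ! head e)

invertible⇒injective : ∀ {p q} → q ⊙ p ≡ ι → ∀ {u v} → p ! u ≡ p ! v → u ≡ v
invertible⇒injective {p} {q} qp {u} {v} eq = trans (sym (back u)) (trans (cong (q !_) eq) (back v))
  where
  back : ∀ u → q ! (p ! u) ≡ u
  back u = trans (sym (⊙-! q p u)) (trans (cong (_! u) qp) (!-tabulate! id u))

perm-! : ∀ g {u v} → perm M₁₁ g ! u ≡ perm M₁₁ g ! v → u ≡ v
perm-! g = invertible⇒injective (proj₁ (proj₂ (closed-⁻¹ M₁₁-closed g)))

M₁₁-group : PermutationGroup 55
M₁₁-group = record
  { Elt      = M₁₁-Elt
  ; _·_      = _·_
  ; ε        = ε
  ; _⁻¹      = _⁻¹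
  ; isGroup  = record
    { isMonoid = record
      { isSemigroup = record
        { isMagma = record { isEquivalence = isEquivalence ; ∙-cong = cong₂ _·_ }
        ; assoc = λ g h k → injective (begin
            perm M₁₁ ((g · h) · k)                         ≡⟨ perm-· (g · h) k ⟩
            perm M₁₁ (g · h) ⊙ perm M₁₁ k                  ≡⟨ cong (_⊙ perm M₁₁ k) (perm-· g h) ⟩
            (perm M₁₁ g ⊙ perm M₁₁ h) ⊙ perm M₁₁ k         ≡⟨ ⊙-assoc (perm M₁₁ g) (perm M₁₁ h) (perm M₁₁ k) ⟩
            perm M₁₁ g ⊙ (perm M₁₁ h ⊙ perm M₁₁ k)         ≡⟨ cong (perm M₁₁ g ⊙_) (perm-· h k) ⟨
            perm M₁₁ g ⊙ perm M₁₁ (h · k)                  ≡⟨ perm-· g (h · k) ⟨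
            perm M₁₁ (g · (h · k))                         ∎) }
      ; identity = (λ g → injective (trans (perm-· ε g) (trans (cong (_⊙ perm M₁₁ g) perm-ε) (⊙-identityˡ (perm M₁₁ g)))))
                 , (λ g → injective (trans (perm-· g ε) (trans (cong (perm M₁₁ g ⊙_) perm-ε) (⊙-identityʳ (perm M₁₁ g))))) }
    ; inverse = (λ g → injective (trans (perm-· (g ⁻¹) g) (trans (proj₁ (proj₂ (closed-⁻¹ M₁₁-closed g))) (sym perm-ε))))
              , (λ g → injective (trans (perm-· g (g ⁻¹)) (trans (proj₂ (proj₂ (closed-⁻¹ M₁₁-closed g))) (sym perm-ε))))
    ; ⁻¹-cong = cong _⁻¹ }
  ; elements = indices M₁₁
  ; complete = ∈-indices M₁₁
  ; unique   = indices-unique M₁₁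
  ; _•_      = _•ᴱ_
  ; •-·      = •-·
  ; •-ε      = λ e → trans (cong₂ edge (fixed (tail e)) (fixed (head e))) (edge-ends e)
  }
  where
  open ≡-Reasoning
  _·_ : M₁₁-Elt → M₁₁-Elt → M₁₁-Elt
  g · h = proj₁ (closed-⊙ M₁₁-closed g h)
  ε : M₁₁-Elt
  ε = proj₁ (closed-ι M₁₁-closed)
  _⁻¹ : M₁₁-Elt → M₁₁-Elt
  g ⁻¹ = proj₁ (closed-⁻¹ M₁₁-closed g)
  injective : ∀ {g h} → perm M₁₁ g ≡ perm M₁₁ h → g ≡ h
  injective = perm-injective M₁₁-closed
  perm-· : ∀ g h → perm M₁₁ (g · h) ≡ perm M₁₁ g ⊙ perm M₁₁ h
  perm-· g h = proj₂ (closed-⊙ M₁₁-closed g h)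
  perm-ε : perm M₁₁ ε ≡ ι
  perm-ε = proj₂ (closed-ι M₁₁-closed)
  fixed : ∀ v → perm M₁₁ ε ! v ≡ v
  fixed v = trans (cong (_! v) perm-ε) (!-tabulate! id v)
  composed : ∀ g h v → perm M₁₁ (g · h) ! v ≡ perm M₁₁ g ! (perm M₁₁ h ! v)
  composed g h v = trans (cong (_! v) (perm-· g h)) (⊙-! (perm M₁₁ g) (perm M₁₁ h) v)
  •-· : ∀ g h e → (g · h) •ᴱ e ≡ g •ᴱ (h •ᴱ e)
  •-· g h e = trans (cong₂ edge (composed g h (tail e)) (composed g h (head e)))
    (sym (edge-elim (λ u v → edge (perm M₁₁ g ! u) (perm M₁₁ g ! v)) (λ u v → edge-sym _ _) (tail≢head e ∘ perm-! h)))

open Action M₁₁-group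

-- The edges p0p1, p0p2 and p2p3: `p` is adjacent to `o`, and `q` is disjoint from it.
o p q : Fin 55
o = zero
p = suc zero
q = # 5

-- The image of the base (p0 , p1 , p2 , p3) that carries (o , p) or (o , q) to the given pair of edges.
baseImage : V × V → V × V → List V
baseImage (a , b) (c , d) with does (a ≟ⱽ c) | does (a ≟ⱽ d) | does (b ≟ⱽ c) | does (b ≟ⱽ d)
... | true  | _     | _     | _     = a ∷ b ∷ d ∷ []
... | false | true  | _     | _     = a ∷ b ∷ c ∷ []
... | false | false | true  | _     = b ∷ a ∷ d ∷ []
... | false | false | false | true  = b ∷ a ∷ c ∷ []
... | false | false | false | false = a ∷ b ∷ c ∷ d ∷ []

-- Sends the base points to prescribed vertices level by level and takes the trivial representative
-- once the targets run out; this avoids a search through all 7920 elements.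
seek : ∀ c → Perm → List V → Maybe (Index c)
seek []      q ts       = just tt
seek (l ∷ c) q []       = Maybe.map (zero ,_) (seek c (q ⊙ factor l zero) [])
seek (l ∷ c) q (t ∷ ts) = firstJust (λ a → if does ((q ! (factor l a ! base l)) ≟ⱽ t)
  then Maybe.map (a ,_) (seek c (q ⊙ factor l a) ts) else nothing) (allFin _)

candidates : List V → List M₁₁-Elt
candidates ts = Maybe.maybe (_∷ []) [] (seek M₁₁ ι ts)

CarriesFrom : Fin 55 → M₁₁-Elt → Set
CarriesFrom f g = g •ᴱ o ≡ o × (g •ᴱ p ≡ f ⊎ g •ᴱ q ≡ f)

opaque
  unfolding M₁₁ _⊙_ edge

  point-transitive : ∀ e → Any (λ g → g •ᴱ o ≡ e) (candidates (tail e ∷ head e ∷ []))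
  point-transitive = witness (all? λ e → Any.any? (λ g → (g •ᴱ o) ≟ᶠ e) (candidates (tail e ∷ head e ∷ []))) refl

  two-suborbits : ∀ f → o ≡ f ⊎ Any (CarriesFrom f) (candidates (baseImage (p0 , p1) (lookup ends f)))
  two-suborbits = witness (all? λ f → (o ≟ᶠ f) ⊎-dec
    Any.any? (λ g → ((g •ᴱ o) ≟ᶠ o) ×-dec (((g •ᴱ p) ≟ᶠ f) ⊎-dec ((g •ᴱ q) ≟ᶠ f))) (candidates (baseImage (p0 , p1) (lookup ends f)))) refl

transitive : ∀ e f → e ≢ f → (∃ λ g → g •ᴱ o ≡ e × g •ᴱ p ≡ f) ⊎ (∃ λ g → g •ᴱ o ≡ e × g •ᴱ q ≡ f)
transitive = rankThree o p q (λ e → Any.satisfied (point-transitive e))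
  (λ f → [ inj₁ , inj₂ ∘ Any.satisfied ]′ (two-suborbits f))

-- Explicit orbits

open RankThree o p q transitive 10

Adjacency : Set
Adjacency = Table (Table Bool)

joins : List (V × V) → V → V → Bool
joins es u v = any (λ (a , b) → does (a ≟ⱽ u) ∧ does (b ≟ⱽ v)) es

opaque
  adjacency : List (V × V) → Adjacency
  adjacency es = tabulate! λ u → tabulate! λ v → joins es u v ∨ joins es v u

  adjacency-! : ∀ es u v → adjacency es ! u ! v ≡ joins es u v ∨ joins es v u
  adjacency-! es u v = trans (cong (_! v) (!-tabulate! (λ u → tabulate! λ v → joins es u v ∨ joins es v u) u))
    (!-tabulate! (λ v → joins es u v ∨ joins es v u) v)

Symmetric : Adjacency → Set
Symmetric m = ∀ u v → m ! u ! v ≡ m ! v ! u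

adjacency-sym : ∀ es → Symmetric (adjacency es)
adjacency-sym es u v = trans (adjacency-! es u v) (trans (∨-comm (joins es u v) (joins es v u)) (sym (adjacency-! es v u)))

opaque
  edgeSet : Adjacency → Subset 55
  edgeSet m = tabulate λ e → m ! tail e ! head e

  lookup-edgeSet : ∀ m e → lookup (edgeSet m) e ≡ m ! tail e ! head e
  lookup-edgeSet m = lookup∘tabulate (λ e → m ! tail e ! head e)

pairTally : Fin 55 → Fin 55 → Adjacency → ℕ
pairTally e f m = tally M₁₁ (λ r → m ! (r ! tail e) ! (r ! head e) ∧ m ! (r ! tail f) ! (r ! head f)) ι

preserves : Adjacency → List (V × V) → Perm → Bool
preserves m es r = all (λ (u , v) → m ! (r ! u) ! (r ! v)) es

stabTally : Adjacency → ℕ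
-- The edge list is passed as an argument so that its evaluation is shared by all group elements.
stabTally m = go (map (lookup ends) (members (edgeSet m)))
  where
  go : List (V × V) → ℕ
  go es = tally M₁₁ (preserves m es) ι

tally-ι : ∀ c f → tally c f ι ≡ count (λ i → T? (f (perm c i))) (indices c)
tally-ι c f = trans (tally≡count c f ι)
  (count-≐ (λ i → T? (f (ι ⊙ perm c i))) (λ i → T? (f (perm c i)))
    (λ {i} → subst (T ∘ f) (⊙-identityˡ (perm c i))) (λ {i} → subst (T ∘ f) (sym (⊙-identityˡ (perm c i)))) (indices c))

module _ (m : Adjacency) (m-sym : Symmetric m) where

  ∈-edgeSet⁺ : ∀ {e} → T (m ! tail e ! head e) → e ∈ edgeSet m
  ∈-edgeSet⁺ {e} t = lookup⇒[]= e (edgeSet m) (trans (lookup-edgeSet m e) (Equivalence.to T-≡ t))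

  ∈-edgeSet⁻ : ∀ {e} → e ∈ edgeSet m → T (m ! tail e ! head e)
  ∈-edgeSet⁻ {e} i = Equivalence.from T-≡ (trans (sym (lookup-edgeSet m e)) ([]=⇒lookup i))

  image-entry : ∀ g e → m ! tail (g •ᴱ e) ! head (g •ᴱ e) ≡ m ! (perm M₁₁ g ! tail e) ! (perm M₁₁ g ! head e)
  image-entry g e = edge-elim (λ u v → m ! u ! v) m-sym (tail≢head e ∘ perm-! g)

  ∈-act-edgeSet⁺ : ∀ g e → T (m ! (perm M₁₁ g ! tail e) ! (perm M₁₁ g ! head e)) → e ∈ act g (edgeSet m)
  ∈-act-edgeSet⁺ g e t = ∈-act⁺ (∈-edgeSet⁺ (subst T (sym (image-entry g e)) t))

  ∈-act-edgeSet⁻ : ∀ g e → e ∈ act g (edgeSet m) → T (m ! (perm M₁₁ g ! tail e) ! (perm M₁₁ g ! head e))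
  ∈-act-edgeSet⁻ g e i = subst T (image-entry g e) (∈-edgeSet⁻ (∈-act⁻ i))

  pairTally≡ : ∀ e f → pairTally e f m ≡ count (λ g → both? e f (act g (edgeSet m))) (indices M₁₁)
  pairTally≡ e f = trans (tally-ι M₁₁ _) (count-≐ _ (λ g → both? e f (act g (edgeSet m)))
    (λ {g} t → let (s , s′) = Equivalence.to T-∧ t in ∈-act-edgeSet⁺ g e s , ∈-act-edgeSet⁺ g f s′)
    (λ {g} (i , j) → Equivalence.from T-∧ (∈-act-edgeSet⁻ g e i , ∈-act-edgeSet⁻ g f j)) (indices M₁₁))

  stabTally≡ : stabTally m ≡ stabiliser (edgeSet m)
  stabTally≡ = trans (tally-ι M₁₁ (preserves m es)) (count-≐ _ (λ g → act g (edgeSet m) ≟ˢ edgeSet m) (λ {g} → to g) (λ {g} → from g) (indices M₁₁))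
    where
    es : List (V × V)
    es = map (lookup ends) (members (edgeSet m))
    to : ∀ g → T (preserves m es (perm M₁₁ g)) → act g (edgeSet m) ≡ edgeSet m
    -- `preserves` gives one inclusion only; equal sizes turn it into an equality.
    to g t = sym (⊆∧∣∣≡ sub (sym (∣act∣ g (edgeSet m))))
      where
      sub : edgeSet m ⊆ act g (edgeSet m)
      sub {e} i = ∈-act-edgeSet⁺ g e (All.lookup (All.all⁺ _ es t) (∈-map⁺ (lookup ends) (∈-members⁺ i)))
      ⊆∧∣∣≡ : ∀ {n} {p q : Subset n} → p ⊆ q → ∣ p ∣ ≡ ∣ q ∣ → p ≡ q
      ⊆∧∣∣≡ {n} {p} {q} p⊆q eq = ⊆-antisym p⊆q q⊆p
        where
        q⊆p : q ⊆ p
        q⊆p {x} x∈q with x ∈? p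
        ... | yes x∈p = x∈p
        ... | no x∉p  = contradiction eq (<⇒≢ (p⊂q⇒∣p∣<∣q∣ (p⊆q , x , x∈q , x∉p)))
    from : ∀ g → act g (edgeSet m) ≡ edgeSet m → T (preserves m es (perm M₁₁ g))
    from g eq = All.all⁻ _ (All.tabulate entry)
      where
      entry : ∀ {uv} → uv ∈ˡ es → T (m ! (perm M₁₁ g ! proj₁ uv) ! (perm M₁₁ g ! proj₂ uv))
      entry i with ∈-map⁻ (lookup ends) i
      ... | e , j , refl = ∈-act-edgeSet⁻ g e (subst (e ∈_) (sym eq) (∈-members⁻ j))

-- `stab-1` is the stabiliser order minus one, so that the order is a successor and can be
-- cancelled.
record Entry : Set where
  constructor orb
  field
    stab-1 x′ y′ : ℕ
    graph        : List (V × V)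

open Entry

record Valid (E : Entry) : Set where
  constructor valid
  field
    isSize : ∣ edgeSet (adjacency (graph E)) ∣ ≡ 10
    isStab : stabTally (adjacency (graph E)) ≡ suc (stab-1 E)
    isX    : pairTally o p (adjacency (graph E)) ≡ x′ E * suc (stab-1 E)
    isY    : pairTally o q (adjacency (graph E)) ≡ y′ E * suc (stab-1 E)

valid? : ∀ E → Dec (Valid E)
valid? E = map′ (λ (a , b , c , d) → valid a b c d) (λ (valid a b c d) → a , b , c , d)
  ((_ ℕ.≟ _) ×-dec (_ ℕ.≟ _) ×-dec (_ ℕ.≟ _) ×-dec (_ ℕ.≟ _))

toOrbit : ∀ E → Valid E → Orbit
toOrbit E v = record
  { rep  = edgeSet m
  ; size = isSize
  ; x    = x′ E
  ; y    = y′ E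
  ; x≡   = size≡ o p (x′ E) isX
  ; y≡   = size≡ o q (y′ E) isY }
  where
  open Valid v
  m : Adjacency
  m = adjacency (graph E)
  m-sym : Symmetric m
  m-sym = adjacency-sym (graph E)
  size≡ : ∀ e f n → pairTally e f m ≡ n * suc (stab-1 E) → pairCount e f (orbit (edgeSet m)) ≡ n
  size≡ e f n eq = *-cancelʳ-≡ _ n (suc (stab-1 E)) (begin
    pairCount e f (orbit (edgeSet m)) * suc (stab-1 E)          ≡⟨ cong (pairCount e f (orbit (edgeSet m)) *_) (trans (sym isStab) (stabTally≡ m m-sym)) ⟩
    pairCount e f (orbit (edgeSet m)) * stabiliser (edgeSet m)  ≡⟨ orbitStabiliser e f (edgeSet m) ⟩
    count (λ g → both? e f (act g (edgeSet m))) (indices M₁₁)   ≡⟨ pairTally≡ m m-sym e f ⟨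
    pairTally e f m                                             ≡⟨ eq ⟩
    n * suc (stab-1 E)                                          ∎)
    where open ≡-Reasoning

-- Imbalances x - y are 1, 3, -4, -3, with subset sums covering -4 to 1. The first orbit consists of
-- the eleven stars; its stabiliser and the third one have orders 720 and 36, both divisible by 9.
correctorsBase : List Entry
correctorsBase =
  orb 719 1 0 ((p0 , pX) ∷ (p1 , pX) ∷ (p2 , pX) ∷ (p3 , pX) ∷ (p4 , pX) ∷ (p5 , pX) ∷ (p6 , pX) ∷ (p7 , pX) ∷ (p8 , pX) ∷ (p9 , pX) ∷ []) ∷
  orb 7 32 29 ((p1 , p2) ∷ (p0 , p4) ∷ (p1 , p4) ∷ (p0 , p7) ∷ (p2 , p7) ∷ (p7 , p8) ∷ (p1 , p9) ∷ (p8 , p9) ∷ (p4 , pX) ∷ (p8 , pX) ∷ []) ∷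
  orb 35 4 8 ((p1 , p2) ∷ (p3 , p4) ∷ (p1 , p5) ∷ (p2 , p5) ∷ (p0 , p6) ∷ (p3 , p7) ∷ (p4 , p7) ∷ (p8 , p9) ∷ (p8 , pX) ∷ (p9 , pX) ∷ []) ∷
  orb 7 28 31 ((p0 , p3) ∷ (p2 , p4) ∷ (p1 , p5) ∷ (p2 , p5) ∷ (p4 , p5) ∷ (p0 , p8) ∷ (p1 , p9) ∷ (p5 , p9) ∷ (p3 , pX) ∷ (p8 , pX) ∷ []) ∷
  []

-- Imbalances 6, 12, 24, 48, 72, 102, -72, -96, -120, -144, 168, 192, 264: each has absolute value
-- at most the length of the interval covered before it, which starts at six values.
correctors : List Entry
correctors =
  orb 11 24 18 ((p0 , p1) ∷ (p0 , p3) ∷ (p1 , p5) ∷ (p3 , p5) ∷ (p0 , p6) ∷ (p5 , p6) ∷ (p2 , p7) ∷ (p1 , p8) ∷ (p3 , p8) ∷ (p6 , p8) ∷ []) ∷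
  orb 7 38 26 ((p4 , p6) ∷ (p5 , p6) ∷ (p0 , p9) ∷ (p1 , p9) ∷ (p2 , p9) ∷ (p3 , p9) ∷ (p7 , p9) ∷ (p8 , p9) ∷ (p4 , pX) ∷ (p5 , pX) ∷ []) ∷
  orb 9 40 16 ((p1 , p2) ∷ (p1 , p3) ∷ (p1 , p7) ∷ (p3 , p7) ∷ (p1 , p9) ∷ (p2 , p9) ∷ (p3 , p9) ∷ (p1 , pX) ∷ (p2 , pX) ∷ (p7 , pX) ∷ []) ∷
  orb 5 72 24 ((p0 , p4) ∷ (p1 , p6) ∷ (p5 , p7) ∷ (p0 , p8) ∷ (p1 , p8) ∷ (p4 , p8) ∷ (p5 , p8) ∷ (p6 , p8) ∷ (p7 , p8) ∷ (p8 , p9) ∷ []) ∷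
  orb 3 108 36 ((p1 , p2) ∷ (p2 , p3) ∷ (p1 , p5) ∷ (p3 , p5) ∷ (p1 , p6) ∷ (p2 , p6) ∷ (p3 , p6) ∷ (p5 , p6) ∷ (p6 , p8) ∷ (p6 , p9) ∷ []) ∷
  orb 3 128 26 ((p1 , p4) ∷ (p0 , p9) ∷ (p1 , p9) ∷ (p2 , p9) ∷ (p4 , p9) ∷ (p5 , p9) ∷ (p6 , p9) ∷ (p8 , p9) ∷ (p6 , pX) ∷ (p9 , pX) ∷ []) ∷
  orb 1 72 144 ((p0 , p3) ∷ (p2 , p4) ∷ (p1 , p5) ∷ (p0 , p6) ∷ (p5 , p7) ∷ (p3 , p8) ∷ (p6 , p8) ∷ (p7 , p9) ∷ (p1 , pX) ∷ (p9 , pX) ∷ []) ∷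
  orb 0 176 272 ((p0 , p2) ∷ (p1 , p4) ∷ (p1 , p5) ∷ (p1 , p7) ∷ (p0 , p8) ∷ (p2 , p8) ∷ (p2 , p9) ∷ (p3 , p9) ∷ (p5 , pX) ∷ (p6 , pX) ∷ []) ∷
  orb 0 160 280 ((p0 , p3) ∷ (p2 , p5) ∷ (p4 , p5) ∷ (p1 , p6) ∷ (p6 , p7) ∷ (p7 , p8) ∷ (p3 , p9) ∷ (p8 , p9) ∷ (p1 , pX) ∷ (p7 , pX) ∷ []) ∷
  orb 0 144 288 ((p0 , p2) ∷ (p1 , p3) ∷ (p2 , p5) ∷ (p3 , p5) ∷ (p0 , p6) ∷ (p4 , p7) ∷ (p1 , p9) ∷ (p8 , p9) ∷ (p6 , pX) ∷ (p7 , pX) ∷ []) ∷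
  orb 1 232 64 ((p0 , p2) ∷ (p2 , p3) ∷ (p2 , p5) ∷ (p2 , p7) ∷ (p2 , p8) ∷ (p2 , p9) ∷ (p7 , p9) ∷ (p2 , pX) ∷ (p5 , pX) ∷ (p7 , pX) ∷ []) ∷
  orb 1 248 56 ((p0 , p6) ∷ (p1 , p6) ∷ (p2 , p6) ∷ (p3 , p6) ∷ (p4 , p6) ∷ (p6 , p7) ∷ (p5 , p8) ∷ (p6 , p8) ∷ (p6 , p9) ∷ (p8 , pX) ∷ []) ∷
  orb 0 416 152 ((p0 , p5) ∷ (p0 , p7) ∷ (p3 , p7) ∷ (p5 , p7) ∷ (p2 , p9) ∷ (p3 , p9) ∷ (p5 , p9) ∷ (p7 , p9) ∷ (p7 , pX) ∷ (p9 , pX) ∷ []) ∷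
  []

-- Large stabilisers make x and y small, so that balanced subsets reach 48 consecutive values; the
-- lightest bundle, of weight 40, can then be added without a gap.
fillersBase : List Entry
fillersBase =
  orb 7 36 27 ((p0 , p2) ∷ (p1 , p4) ∷ (p3 , p7) ∷ (p6 , p7) ∷ (p3 , p9) ∷ (p6 , p9) ∷ (p7 , p9) ∷ (p3 , pX) ∷ (p6 , pX) ∷ (p7 , pX) ∷ []) ∷
  orb 9 24 24 ((p1 , p3) ∷ (p1 , p4) ∷ (p0 , p5) ∷ (p1 , p6) ∷ (p1 , p7) ∷ (p1 , p8) ∷ (p0 , p9) ∷ (p2 , p9) ∷ (p2 , pX) ∷ (p5 , pX) ∷ []) ∷
  orb 7 42 24 ((p1 , p2) ∷ (p2 , p3) ∷ (p2 , p4) ∷ (p2 , p5) ∷ (p2 , p6) ∷ (p0 , pX) ∷ (p3 , pX) ∷ (p7 , pX) ∷ (p8 , pX) ∷ (p9 , pX) ∷ []) ∷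
  orb 7 18 36 ((p0 , p3) ∷ (p2 , p3) ∷ (p0 , p6) ∷ (p2 , p6) ∷ (p5 , p7) ∷ (p7 , p8) ∷ (p1 , p9) ∷ (p4 , p9) ∷ (p1 , pX) ∷ (p4 , pX) ∷ []) ∷
  orb 11 20 20 ((p0 , p4) ∷ (p3 , p4) ∷ (p1 , p6) ∷ (p2 , p7) ∷ (p5 , p8) ∷ (p0 , p9) ∷ (p3 , p9) ∷ (p4 , p9) ∷ (p4 , pX) ∷ (p9 , pX) ∷ []) ∷
  orb 7 26 32 ((p0 , p4) ∷ (p1 , p5) ∷ (p0 , p6) ∷ (p4 , p6) ∷ (p0 , p7) ∷ (p4 , p7) ∷ (p6 , p7) ∷ (p2 , p8) ∷ (p3 , p9) ∷ (p3 , pX) ∷ []) ∷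
  orb 11 12 24 ((p1 , p4) ∷ (p0 , p5) ∷ (p2 , p6) ∷ (p3 , p7) ∷ (p0 , p8) ∷ (p2 , p8) ∷ (p1 , p9) ∷ (p4 , p9) ∷ (p5 , pX) ∷ (p6 , pX) ∷ []) ∷
  orb 19 24 6 ((p3 , p4) ∷ (p3 , p6) ∷ (p4 , p6) ∷ (p3 , p7) ∷ (p4 , p7) ∷ (p6 , p7) ∷ (p3 , p8) ∷ (p4 , p8) ∷ (p6 , p8) ∷ (p7 , p8) ∷ []) ∷
  orb 9 16 28 ((p0 , p4) ∷ (p3 , p4) ∷ (p1 , p6) ∷ (p2 , p6) ∷ (p2 , p7) ∷ (p0 , p8) ∷ (p7 , p9) ∷ (p8 , p9) ∷ (p1 , pX) ∷ (p3 , pX) ∷ []) ∷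
  orb 19 12 12 ((p0 , p1) ∷ (p1 , p4) ∷ (p3 , p4) ∷ (p1 , p5) ∷ (p1 , p6) ∷ (p2 , p6) ∷ (p1 , p8) ∷ (p7 , p8) ∷ (p0 , p9) ∷ (p5 , pX) ∷ []) ∷
  orb 15 9 18 ((p0 , p3) ∷ (p2 , p3) ∷ (p1 , p6) ∷ (p4 , p7) ∷ (p5 , p7) ∷ (p1 , p8) ∷ (p6 , p9) ∷ (p8 , p9) ∷ (p4 , pX) ∷ (p5 , pX) ∷ []) ∷
  orb 119 4 1 ((p1 , p3) ∷ (p1 , p4) ∷ (p3 , p4) ∷ (p1 , p7) ∷ (p3 , p7) ∷ (p4 , p7) ∷ (p1 , p9) ∷ (p3 , p9) ∷ (p4 , p9) ∷ (p7 , p9) ∷ []) ∷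
  []

-- The single orbits are those with x = y = 240 / s; the pairs consist of orbits with opposite
-- imbalances.
fillers : List (List Entry)
fillers =
  (orb 5 40 40 ((p0 , p2) ∷ (p0 , p4) ∷ (p2 , p4) ∷ (p3 , p6) ∷ (p0 , p7) ∷ (p1 , p7) ∷ (p2 , p7) ∷ (p4 , p7) ∷ (p5 , p8) ∷ (p9 , pX) ∷ []) ∷ []) ∷
  (orb 4 48 48 ((p0 , p3) ∷ (p3 , p6) ∷ (p2 , p7) ∷ (p4 , p7) ∷ (p6 , p7) ∷ (p3 , p8) ∷ (p4 , p8) ∷ (p5 , p8) ∷ (p6 , p9) ∷ (p4 , pX) ∷ []) ∷ []) ∷
  (orb 3 60 60 ((p0 , p2) ∷ (p1 , p4) ∷ (p1 , p5) ∷ (p3 , p5) ∷ (p4 , p5) ∷ (p3 , p6) ∷ (p5 , p6) ∷ (p5 , p7) ∷ (p7 , p8) ∷ (p9 , pX) ∷ []) ∷ []) ∷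
  (orb 2 80 80 ((p2 , p3) ∷ (p2 , p4) ∷ (p1 , p5) ∷ (p5 , p6) ∷ (p2 , p7) ∷ (p2 , p8) ∷ (p1 , p9) ∷ (p0 , pX) ∷ (p1 , pX) ∷ (p5 , pX) ∷ []) ∷ []) ∷
  (orb 1 120 120 ((p2 , p4) ∷ (p3 , p5) ∷ (p3 , p6) ∷ (p5 , p6) ∷ (p6 , p7) ∷ (p3 , p8) ∷ (p5 , p8) ∷ (p7 , p8) ∷ (p2 , p9) ∷ (p9 , pX) ∷ []) ∷ []) ∷
  (orb 0 240 240 ((p0 , p3) ∷ (p2 , p3) ∷ (p3 , p4) ∷ (p3 , p6) ∷ (p0 , p7) ∷ (p5 , p7) ∷ (p2 , p8) ∷ (p7 , p8) ∷ (p4 , p9) ∷ (p6 , p9) ∷ []) ∷ []) ∷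
  (orb 0 256 232 ((p0 , p3) ∷ (p1 , p3) ∷ (p4 , p5) ∷ (p0 , p6) ∷ (p2 , p6) ∷ (p0 , p8) ∷ (p5 , p8) ∷ (p6 , p8) ∷ (p5 , p9) ∷ (p8 , pX) ∷ []) ∷
   orb 0 224 248 ((p1 , p2) ∷ (p1 , p3) ∷ (p3 , p4) ∷ (p1 , p5) ∷ (p4 , p7) ∷ (p0 , p8) ∷ (p1 , p9) ∷ (p4 , p9) ∷ (p3 , pX) ∷ (p6 , pX) ∷ []) ∷ []) ∷
  (orb 0 272 224 ((p0 , p1) ∷ (p0 , p4) ∷ (p3 , p4) ∷ (p0 , p5) ∷ (p3 , p5) ∷ (p2 , p6) ∷ (p0 , p7) ∷ (p3 , pX) ∷ (p4 , pX) ∷ (p6 , pX) ∷ []) ∷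
   orb 0 208 256 ((p0 , p1) ∷ (p0 , p4) ∷ (p3 , p5) ∷ (p0 , p6) ∷ (p3 , p7) ∷ (p5 , p7) ∷ (p6 , p8) ∷ (p0 , p9) ∷ (p1 , pX) ∷ (p9 , pX) ∷ []) ∷ []) ∷
  (orb 0 288 216 ((p0 , p1) ∷ (p1 , p2) ∷ (p0 , p5) ∷ (p1 , p5) ∷ (p1 , p6) ∷ (p2 , p6) ∷ (p3 , p8) ∷ (p5 , p8) ∷ (p0 , pX) ∷ (p8 , pX) ∷ []) ∷
   orb 0 192 264 ((p2 , p5) ∷ (p4 , p5) ∷ (p6 , p7) ∷ (p1 , p8) ∷ (p3 , p8) ∷ (p7 , p9) ∷ (p0 , pX) ∷ (p1 , pX) ∷ (p2 , pX) ∷ (p4 , pX) ∷ []) ∷ []) ∷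
  (orb 1 128 116 ((p0 , p3) ∷ (p0 , p6) ∷ (p1 , p6) ∷ (p1 , p8) ∷ (p5 , p8) ∷ (p6 , p8) ∷ (p1 , p9) ∷ (p7 , p9) ∷ (p5 , pX) ∷ (p8 , pX) ∷ []) ∷
   orb 1 112 124 ((p0 , p4) ∷ (p2 , p5) ∷ (p2 , p6) ∷ (p2 , p7) ∷ (p0 , p8) ∷ (p5 , p8) ∷ (p1 , p9) ∷ (p0 , pX) ∷ (p5 , pX) ∷ (p6 , pX) ∷ []) ∷ []) ∷
  (orb 1 136 112 ((p0 , p3) ∷ (p3 , p5) ∷ (p0 , p6) ∷ (p5 , p6) ∷ (p1 , p9) ∷ (p5 , p9) ∷ (p6 , p9) ∷ (p8 , p9) ∷ (p1 , pX) ∷ (p8 , pX) ∷ []) ∷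
   orb 1 104 128 ((p0 , p2) ∷ (p1 , p5) ∷ (p3 , p6) ∷ (p6 , p7) ∷ (p3 , p8) ∷ (p4 , p8) ∷ (p3 , p9) ∷ (p6 , p9) ∷ (p8 , p9) ∷ (p1 , pX) ∷ []) ∷ []) ∷
  (orb 1 144 108 ((p2 , p5) ∷ (p5 , p6) ∷ (p4 , p7) ∷ (p6 , p7) ∷ (p5 , p8) ∷ (p7 , p8) ∷ (p4 , p9) ∷ (p5 , p9) ∷ (p2 , pX) ∷ (p7 , pX) ∷ []) ∷
   orb 1 96 132 ((p1 , p3) ∷ (p3 , p4) ∷ (p4 , p5) ∷ (p4 , p7) ∷ (p6 , p7) ∷ (p2 , p8) ∷ (p0 , p9) ∷ (p5 , p9) ∷ (p0 , pX) ∷ (p4 , pX) ∷ []) ∷ []) ∷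
  []

-- Assembling the designs

open Selection x y using (Offset; Covers; Covers±; covers-bundles; covers±-items; fits?; fits±?; sum-map-++; module Combine)

opaque
  unfolding M₁₁ _⊙_ adjacency edgeSet

  correctorsBase-valid : All Valid correctorsBase
  correctorsBase-valid = witness (All.all? valid? correctorsBase) refl

  correctors-valid : All Valid correctors
  correctors-valid = witness (All.all? valid? correctors) refl

  fillersBase-valid : All Valid fillersBase
  fillersBase-valid = witness (All.all? valid? fillersBase) refl

  fillers-valid : All (All Valid) fillers
  fillers-valid = witness (All.all? (All.all? valid?) fillers) refl

opaque
  unfolding M₁₁ _⊙_ edge

  pairStabiliser-op : pairStabiliser o p ≡ 8
  pairStabiliser-op = refl

  pairStabiliser-oq : pairStabiliser o q ≡ 4
  pairStabiliser-oq = refl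

toOrbits : ∀ Es → All Valid Es → List Orbit
toOrbits []       _ = []
toOrbits (E ∷ Es) v = toOrbit E (All.head v) ∷ toOrbits Es (All.tail v)

toBundles : ∀ Ess → All (All Valid) Ess → List (List Orbit)
toBundles []         _ = []
toBundles (Es ∷ Ess) v = toOrbits Es (All.head v) ∷ toBundles Ess (All.tail v)

C₀ C₁ F₀ : List Orbit
C₀ = toOrbits correctorsBase correctorsBase-valid
C₁ = toOrbits correctors correctors-valid
F₀ = toOrbits fillersBase fillersBase-valid

F₁ : List (List Orbit)
F₁ = toBundles fillers fillers-valid

reserve : List Orbit
reserve = (C₀ ++ C₁) ++ (F₀ ++ concat F₁)

interval : (P : ℕ → Set) (l n : ℕ) → (∀ (i : Fin n) → P (l + toℕ i)) → ∀ u → l ≤ u → u < l + n → P u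
interval P l n h u l≤u u<l+n = subst P (trans (cong (l +_) (toℕ-fromℕ< lt)) (ℕ.m+[n∸m]≡n l≤u)) (h (fromℕ< lt))
  where
  lt : u ∸ l < n
  lt = ℕ.+-cancelˡ-< l (u ∸ l) n (subst (_< l + n) (sym (ℕ.m+[n∸m]≡n l≤u)) u<l+n)

mask : ℕ → List ℕ → List Bool
mask n is = map (λ i → any (i ≡ᵇ_) is) (upTo n)

-- Row i lists positions in C₀ of orbits with Σ (x − y) = i − 4.
corrections : Vec (List ℕ) 6
corrections = (2 ∷ []) ∷ (3 ∷ []) ∷ (0 ∷ 3 ∷ []) ∷ (1 ∷ 2 ∷ []) ∷ [] ∷ (0 ∷ []) ∷ []

corrections-cover : Covers± C₀ 7 3 8
corrections-cover u lo hi = interval (λ u → Split C₀ (Offset 7 u)) 3 6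
  (λ i → split-map (λ { refl → table-ok i }) (split-pick (mask 4 (lookup corrections i)) C₀)) u lo (s≤s hi)
  where
  table-ok : ∀ i → Offset 7 (3 + toℕ i) (pick (mask 4 (lookup corrections i)) C₀)
  table-ok = witness (all? λ i → X (pick (mask 4 (lookup corrections i)) C₀) + 7 ℕ.≟ Y (pick (mask 4 (lookup corrections i)) C₀) + (3 + toℕ i)) refl

-- Row i lists positions in F₀ of orbits with Σ x = Σ y = 76 + i.
fillings : Vec (List ℕ) 48
fillings =
  (0 ∷ 1 ∷ 6 ∷ 11 ∷ []) ∷ (0 ∷ 4 ∷ 9 ∷ 10 ∷ []) ∷ (1 ∷ 3 ∷ 7 ∷ 9 ∷ []) ∷
  (2 ∷ 6 ∷ 9 ∷ 10 ∷ 11 ∷ []) ∷ (2 ∷ 3 ∷ 4 ∷ []) ∷ (0 ∷ 1 ∷ 9 ∷ 10 ∷ []) ∷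
  (4 ∷ 5 ∷ 6 ∷ 7 ∷ []) ∷ (2 ∷ 8 ∷ 9 ∷ 10 ∷ 11 ∷ []) ∷ (1 ∷ 2 ∷ 3 ∷ []) ∷
  (1 ∷ 6 ∷ 7 ∷ 9 ∷ 10 ∷ 11 ∷ []) ∷ (1 ∷ 3 ∷ 4 ∷ 7 ∷ []) ∷ (0 ∷ 3 ∷ 7 ∷ 10 ∷ []) ∷
  (0 ∷ 1 ∷ 6 ∷ 9 ∷ 11 ∷ []) ∷ (0 ∷ 1 ∷ 4 ∷ 10 ∷ []) ∷ (1 ∷ 5 ∷ 7 ∷ 8 ∷ []) ∷
  (1 ∷ 2 ∷ 6 ∷ 10 ∷ 11 ∷ []) ∷ (2 ∷ 3 ∷ 4 ∷ 9 ∷ []) ∷ (1 ∷ 4 ∷ 6 ∷ 7 ∷ 10 ∷ 11 ∷ []) ∷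
  (4 ∷ 5 ∷ 6 ∷ 7 ∷ 9 ∷ []) ∷ (1 ∷ 2 ∷ 8 ∷ 10 ∷ 11 ∷ []) ∷ (1 ∷ 2 ∷ 3 ∷ 9 ∷ []) ∷
  (1 ∷ 4 ∷ 7 ∷ 8 ∷ 10 ∷ 11 ∷ []) ∷ (1 ∷ 3 ∷ 4 ∷ 7 ∷ 9 ∷ []) ∷ (0 ∷ 3 ∷ 7 ∷ 9 ∷ 10 ∷ []) ∷
  (2 ∷ 4 ∷ 5 ∷ 6 ∷ []) ∷ (0 ∷ 1 ∷ 4 ∷ 9 ∷ 10 ∷ []) ∷ (1 ∷ 5 ∷ 7 ∷ 8 ∷ 9 ∷ []) ∷
  (1 ∷ 2 ∷ 6 ∷ 9 ∷ 10 ∷ 11 ∷ []) ∷ (1 ∷ 2 ∷ 3 ∷ 4 ∷ []) ∷ (0 ∷ 2 ∷ 3 ∷ 10 ∷ []) ∷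
  (1 ∷ 4 ∷ 5 ∷ 6 ∷ 7 ∷ []) ∷ (0 ∷ 3 ∷ 4 ∷ 7 ∷ 10 ∷ []) ∷ (1 ∷ 2 ∷ 5 ∷ 8 ∷ []) ∷
  (2 ∷ 3 ∷ 6 ∷ 7 ∷ 10 ∷ 11 ∷ []) ∷ (1 ∷ 4 ∷ 5 ∷ 7 ∷ 8 ∷ []) ∷ (0 ∷ 1 ∷ 3 ∷ 7 ∷ 10 ∷ []) ∷
  (2 ∷ 4 ∷ 5 ∷ 6 ∷ 9 ∷ []) ∷ (2 ∷ 3 ∷ 7 ∷ 8 ∷ 10 ∷ 11 ∷ []) ∷ (0 ∷ 3 ∷ 4 ∷ 6 ∷ 7 ∷ 11 ∷ []) ∷
  (1 ∷ 2 ∷ 4 ∷ 8 ∷ 10 ∷ 11 ∷ []) ∷ (1 ∷ 2 ∷ 3 ∷ 4 ∷ 9 ∷ []) ∷ (0 ∷ 2 ∷ 3 ∷ 9 ∷ 10 ∷ []) ∷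
  (1 ∷ 4 ∷ 5 ∷ 6 ∷ 7 ∷ 9 ∷ []) ∷ (0 ∷ 3 ∷ 4 ∷ 7 ∷ 9 ∷ 10 ∷ []) ∷ (1 ∷ 2 ∷ 5 ∷ 8 ∷ 9 ∷ []) ∷
  (2 ∷ 3 ∷ 6 ∷ 7 ∷ 9 ∷ 10 ∷ 11 ∷ []) ∷ (2 ∷ 3 ∷ 5 ∷ 6 ∷ 7 ∷ []) ∷ (0 ∷ 1 ∷ 3 ∷ 7 ∷ 9 ∷ 10 ∷ []) ∷
  []

fillings-cover : Covers F₀ 76 123
fillings-cover u lo hi = interval (λ u → Split F₀ (Balanced u)) 76 48
  (λ i → split-map (λ { refl → table-ok i }) (split-pick (mask 12 (lookup fillings i)) F₀)) u lo (s≤s hi)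
  where
  table-ok : ∀ i → Balanced (76 + toℕ i) (pick (mask 12 (lookup fillings i)) F₀)
  table-ok = witness (all? λ i → (X (pick (mask 12 (lookup fillings i)) F₀) ℕ.≟ 76 + toℕ i)
    ×-dec (Y (pick (mask 12 (lookup fillings i)) F₀) ℕ.≟ 76 + toℕ i)) refl

-- 439 is Σ (y − x) over the correctors with x < y.
correctors-cover : Covers± (C₀ ++ C₁) 439 3 1328
correctors-cover = covers±-items C₁ (witness (fits±? 3 8 C₁) refl) corrections-cover

-- 2871 = 123 + 2748, where 2748 is the total of the bundles.
fillers-cover : Covers (F₀ ++ concat F₁) 76 2871
fillers-cover = covers-bundles F₁ (witness (fits? 76 123 F₁) refl) fillings-cover

reserve-unique : Unique (blocks reserve)
reserve-unique = blocks-unique reserve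
  (witness (UniqueDec.unique? (≡-dec ℕ._≟_ ℕ._≟_) (map (λ O → x O , y O) reserve)) refl)

x≤800 : ∀ O → x O ≤ 800
x≤800 O = subst₂ _≤_ (x≡ O) (cong₂ _*_ (cong₂ _*_ (size O) (size O)) pairStabiliser-op) (orbit-pairCount≤ o p (rep O))

y≤400 : ∀ O → y O ≤ 400
y≤400 O = subst₂ _≤_ (y≡ O) (cong₂ _*_ (cong₂ _*_ (size O) (size O)) pairStabiliser-oq) (orbit-pairCount≤ o q (rep O))

-- 886322710 = C(53,8)
module Assembly (Ps : List Orbit) (u : Unique (blocks (reserve ++ Ps))) (total : Balanced 886322710 (reserve ++ Ps)) where

  X-Ps : X Ps ≡ 886317796
  X-Ps = ℕ.+-cancelˡ-≡ 4914 (X Ps) 886317796 (trans (sym (sum-map-++ x reserve Ps)) (proj₁ total))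

  Y-Ps : Y Ps ≡ 886318240
  Y-Ps = ℕ.+-cancelˡ-≡ 4470 (Y Ps) 886318240 (trans (sym (sum-map-++ y reserve Ps)) (proj₂ total))

  -- 883 = 439 + 444, where 444 = 4914 - 4470 is Σ x - Σ y over the reserve; the orbits outside it
  -- have the opposite imbalance.
  imbalance : X Ps + 883 ≡ Y Ps + 439
  imbalance = trans (cong (_+ 883) X-Ps) (sym (cong (_+ 439) Y-Ps))

  mediumDesign : ∀ m → 76 ≤ m → m ≤ 2871 → SimpleDesign 2 55 10 m
  mediumDesign m lo hi = selectionDesign (reserve ++ Ps) u
    (split-++ (λ { {zs} g refl → subst (Balanced m) (sym (++-identityʳ zs)) g })
      (split-++ (λ { refl g → g }) (split-none (C₀ ++ C₁)) (fillers-cover m lo hi)) (split-none Ps))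

  largeDesign : ∀ m → 2871 < m → m ≤ 443161355 → SimpleDesign 2 55 10 m
  largeDesign m 2871<m m≤M = selectionDesign (reserve ++ Ps) u
    (combine Ps imbalance m (ℕ.≤-trans (≤-dec 1999 2871) (ℕ.<⇒≤ 2871<m))
      (ℕ.≤-trans m≤M (subst (443161355 ≤_) (sym X-Ps) (≤-dec 443161355 886317796))))
    where
    ≤-dec : ∀ a b → {t : T (a ≤ᵇ b)} → a ≤ b
    ≤-dec a b {t} = ℕ.≤ᵇ⇒≤ a b t
    -- The window runs from 83 to 1283 and must lie in 3 to 1328. Σ x over all correctors is 1923,
    -- so `room` reads 1923 + 76 + 800 = 2799 ≤ 2871, and 1999 above is 1923 + 76.
    open Combine correctors-cover fillers-cover 800 400 x≤800 y≤400 883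
      (≤-dec 1 800) (≤-dec 800 883) (≤-dec 803 883) (≤-dec 1283 1328) (≤-dec 883 1239) (≤-dec 439 1283) (≤-dec 2799 2871)
      using (combine)

allOrbits : ∃ λ Ps → Unique (blocks (reserve ++ Ps)) × Balanced 886322710 (reserve ++ Ps)
allOrbits = extend reserve reserve-unique 8 refl refl refl

orbitDesign : ∀ m → 76 ≤ m → m ≤ 443161355 → SimpleDesign 2 55 10 m
orbitDesign m 76≤m m≤M = from allOrbits (m ≤? 2871)
  where
  from : (∃ λ Ps → Unique (blocks (reserve ++ Ps)) × Balanced 886322710 (reserve ++ Ps)) →
    Dec (m ≤ 2871) → SimpleDesign 2 55 10 m
  from (Ps , u , total) (yes m≤2871) = Assembly.mediumDesign Ps u total m 76≤m m≤2871
  from (Ps , u , total) (no m≰2871)  = Assembly.largeDesign Ps u total m (ℕ.≰⇒> m≰2871) m≤M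

theorem2 : (m : ℕ) → (m ≡ 4 ⊎ m ≡ 5 ⊎ (8 ≤ m × m ≤ 443161355)) →
    SimpleDesign 2 55 10 m
theorem2 m (inj₁ refl) = smallDesign 4 (ℕ.≤ᵇ⇒≤ 5 76 tt) (inj₂ (inj₁ refl))
theorem2 m (inj₂ (inj₁ refl)) = smallDesign 5 (ℕ.≤ᵇ⇒≤ 6 76 tt) (inj₂ (inj₂ refl))
theorem2 m (inj₂ (inj₂ (8≤m , m≤M))) with m <? 76
... | yes m<76 = smallDesign m m<76 (inj₁ 8≤m)
... | no m≮76  = orbitDesign m (ℕ.≮⇒≥ m≮76) m≤M
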